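{- Let $\mathbf{B}$ be a 2-element algebra with universe $\{0,1\}$ such that at least one of the following holds: (1) $\mathbf{B}\preceq\boldsymbol{\bigwedge}$, (2) $\mathbf{B}\preceq\boldsymbol{\bigvee}$, or (3) $\mathbf{B}\preceq\mathsf{U}$. Let $\mathbf{A}=\mathbf{B}^n$. Then any quantum algorithm which solves $\mathrm{HKP}(\mathbf{A})$ must make $\Omega((1+\epsilon)^n)$ queries to the oracle, for $0<\epsilon<1$.
   Context: $\mathrm{Clo}(\mathbf{B})$ is the clone of term operations of $\mathbf{B}$ (smallest set of operations on $\{0,1\}$ containing the basic operations and projections, closed under composition). For a clone $\mathcal{C}$ on $\{0,1\}$, $\mathbf{B}\preceq\mathcal{C}$ means $\mathrm{Clo}(\mathbf{B})\subseteq\mathcal{C}$. $\boldsymbol{\bigwedge}$ is the clone generated by $x\wedge y$ and the constants $0,1$; $\boldsymbol{\bigvee}$ is the clone generated by $x\vee y$ and the constants $0,1$; $\mathsf{U}$ is the clone generated by $\neg x$ and the constant $0$. $\mathbf{B}^n$ is the direct power with coordinatewise operations. A congruence is an equivalence relation compatible with all operations; $\ker(\phi)=\{(a,b):\phi(a)=\phi(b)\}$. The Hidden Kernel Problem $\mathrm{HKP}(\mathbf{A})$: given a similar algebra $\mathbf{C}$ and a homomorphism $\phi:\mathbf{A}\to\mathbf{C}$ accessible only as an oracle, determine the congruence $\ker(\phi)$. -}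

module Defs where

open import Data.Bool.Base using (Bool; true; false; if_then_else_; _∧_; _∨_; not; _xor_)
import Data.Bool.Properties as Bool
open import Data.Fin.Base using (Fin)
open import Data.Integer.Base using (+_)
open import Data.List.Base using (List; foldl; length)
open import Data.Nat.Base as ℕ using (ℕ; zero; suc)
import Data.Nat.Properties as ℕ
open import Data.Product.Base using (∃-syntax; _×_; _,_; proj₁; proj₂)
import Data.Product.Properties as Product
open import Data.Rational.Base as ℚ using (ℚ; 0ℚ; 1ℚ; ½; _/_; 1/_; ∣_∣)
import Data.Rational.Properties as ℚ
open import Data.Rational.Solver using (module +-*-Solver)
open import Data.Vec.Base using (Vec; []; _∷_; lookup; map; tabulate; replicate; zipWith)
import Data.Vec.Properties as Vec
open import Function.Base using (_∘_)
open import Function.Bundles using (_⇔_; mk⇔; _↣_; Equivalence; Injection)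
open import Level using (Level; _⊔_) renaming (zero to 0ℓ; suc to lsuc)
open import Relation.Binary.Definitions using (DecidableEquality)
open import Relation.Binary.PropositionalEquality
  using (_≡_; refl; sym; cong; subst; subst₂; _≗_)
open import Relation.Nullary.Decidable
  using (Dec; does; map′; _×-dec_; _→-dec_; via-injection)

private
  variable
    o : Level
    n ℓ w : ℕ

Eventually : (ℕ → Set) → Set
Eventually P = ∃[ N ] ∀ n → N ℕ.≤ n → P n

IsCauchy : (ℕ → ℚ) → Set
IsCauchy s = ∀ δ → 0ℚ ℚ.< δ →
  ∃[ N ] ∀ m n → N ℕ.≤ m → N ℕ.≤ n → ∣ s m ℚ.- s n ∣ ℚ.< δ

-- Real numbers are Cauchy sequences of rationals; equality of reals is
-- the relation _≃ʳ_ below, not _≡_.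
record ℝ : Set where
  constructor mkℝ
  field
    seq    : ℕ → ℚ
    cauchy : IsCauchy seq
open ℝ public

infix 4 _≃ʳ_ _≤ʳ_ _<ʳ_

_≃ʳ_ _≤ʳ_ _<ʳ_ : ℝ → ℝ → Set
x ≃ʳ y = ∀ δ → 0ℚ ℚ.< δ → Eventually λ n → ∣ seq x n ℚ.- seq y n ∣ ℚ.< δ
x ≤ʳ y = ∀ δ → 0ℚ ℚ.< δ → Eventually λ n → seq x n ℚ.≤ seq y n ℚ.+ δ
x <ʳ y = ∃[ δ ] 0ℚ ℚ.< δ × Eventually λ n → seq x n ℚ.+ δ ℚ.≤ seq y n

private
  half-pos : ∀ {δ} → 0ℚ ℚ.< δ → 0ℚ ℚ.< ½ ℚ.* δ
  half-pos {δ} 0<δ = ℚ.*-monoʳ-<-pos ½ 0<δ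

  halves : ∀ δ → ½ ℚ.* δ ℚ.+ ½ ℚ.* δ ≡ δ
  halves δ = begin-equality
    ½ ℚ.* δ ℚ.+ ½ ℚ.* δ  ≡⟨ sym (ℚ.*-distribʳ-+ δ ½ ½) ⟩
    (½ ℚ.+ ½) ℚ.* δ      ≡⟨ ℚ.*-identityˡ δ ⟩
    δ                    ∎
    where open ℚ.≤-Reasoning

  const-cauchy : ∀ q → IsCauchy (λ _ → q)
  const-cauchy q δ 0<δ = 0 , λ _ _ _ _ →
    subst (ℚ._< δ) (sym (cong ∣_∣ (ℚ.+-inverseʳ q))) 0<δ

  neg-cauchy : ∀ {s} → IsCauchy s → IsCauchy (ℚ.-_ ∘ s)
  neg-cauchy {s} cs δ 0<δ with cs δ 0<δ
  ... | N , close = N , λ m n N≤m N≤n → begin-strict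
    ∣ ℚ.- s m ℚ.- ℚ.- s n ∣  ≡⟨ cong ∣_∣ (sym (ℚ.neg-distrib-+ (s m) (ℚ.- s n))) ⟩
    ∣ ℚ.- (s m ℚ.- s n) ∣    ≡⟨ ℚ.∣-p∣≡∣p∣ (s m ℚ.- s n) ⟩
    ∣ s m ℚ.- s n ∣          <⟨ close m n N≤m N≤n ⟩
    δ                        ∎
    where open ℚ.≤-Reasoning

  +-cauchy : ∀ {s t} → IsCauchy s → IsCauchy t → IsCauchy (λ n → s n ℚ.+ t n)
  +-cauchy {s} {t} cs ct δ 0<δ with cs (½ ℚ.* δ) (half-pos 0<δ) | ct (½ ℚ.* δ) (half-pos 0<δ)
  ... | N , s-close | M , t-close = N ℕ.⊔ M , λ m n ≤m ≤n → begin-strict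
    ∣ (s m ℚ.+ t m) ℚ.- (s n ℚ.+ t n) ∣
      ≡⟨ cong ∣_∣ (solve 4 (λ a b c d →
           (a :+ b) :- (c :+ d) := (a :- c) :+ (b :- d)) refl (s m) (t m) (s n) (t n)) ⟩
    ∣ (s m ℚ.- s n) ℚ.+ (t m ℚ.- t n) ∣
      ≤⟨ ℚ.∣p+q∣≤∣p∣+∣q∣ (s m ℚ.- s n) (t m ℚ.- t n) ⟩
    ∣ s m ℚ.- s n ∣ ℚ.+ ∣ t m ℚ.- t n ∣
      <⟨ ℚ.+-mono-< (s-close m n (ℕ.m⊔n≤o⇒m≤o N M ≤m) (ℕ.m⊔n≤o⇒m≤o N M ≤n))
                    (t-close m n (ℕ.m⊔n≤o⇒n≤o N M ≤m) (ℕ.m⊔n≤o⇒n≤o N M ≤n)) ⟩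
    ½ ℚ.* δ ℚ.+ ½ ℚ.* δ  ≡⟨ halves δ ⟩
    δ                    ∎
    where open ℚ.≤-Reasoning
          open +-*-Solver

  bound : ∀ {s} → IsCauchy s →
    ∃[ b ] ℚ.Positive b × Eventually λ n → ∣ s n ∣ ℚ.≤ b
  bound {s} cs with cs 1ℚ (ℚ.positive⁻¹ 1ℚ)
  ... | N , close = 1ℚ ℚ.+ ∣ s N ∣
    , ℚ.pos+nonNeg⇒pos 1ℚ ∣ s N ∣ {{ℚ.∣-∣-nonNeg (s N)}}
    , N , λ n N≤n → begin
    ∣ s n ∣                        ≡⟨ cong ∣_∣ (solve 2 (λ a b → a := (a :- b) :+ b) refl (s n) (s N)) ⟩
    ∣ (s n ℚ.- s N) ℚ.+ s N ∣      ≤⟨ ℚ.∣p+q∣≤∣p∣+∣q∣ (s n ℚ.- s N) (s N) ⟩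
    ∣ s n ℚ.- s N ∣ ℚ.+ ∣ s N ∣    ≤⟨ ℚ.+-monoˡ-≤ ∣ s N ∣ (ℚ.<⇒≤ (close n N N≤n ℕ.≤-refl)) ⟩
    1ℚ ℚ.+ ∣ s N ∣                 ∎
    where open ℚ.≤-Reasoning
          open +-*-Solver

  scale : ∀ b → .{{ℚ.Positive b}} → ∀ {δ} → 0ℚ ℚ.< δ →
    ∃[ η ] 0ℚ ℚ.< η × (∀ p q → ∣ p ∣ ℚ.≤ b → ∣ q ∣ ℚ.< η → ∣ p ℚ.* q ∣ ℚ.< δ)
  scale b {δ} 0<δ = η , 0<η , λ p q p≤b q<η → begin-strict
    ∣ p ℚ.* q ∣        ≡⟨ ℚ.∣p*q∣≡∣p∣*∣q∣ p q ⟩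
    ∣ p ∣ ℚ.* ∣ q ∣    ≤⟨ ℚ.*-monoʳ-≤-nonNeg ∣ q ∣ {{ℚ.∣-∣-nonNeg q}} p≤b ⟩
    b ℚ.* ∣ q ∣        <⟨ ℚ.*-monoʳ-<-pos b q<η ⟩
    b ℚ.* (b⁻¹ ℚ.* δ)  ≡⟨ sym (ℚ.*-assoc b b⁻¹ δ) ⟩
    (b ℚ.* b⁻¹) ℚ.* δ  ≡⟨ cong (ℚ._* δ) (ℚ.*-inverseʳ b) ⟩
    1ℚ ℚ.* δ           ≡⟨ ℚ.*-identityˡ δ ⟩
    δ                  ∎
    where
    open ℚ.≤-Reasoning
    instance
      b≢0 : ℚ.NonZero b
      b≢0 = ℚ.pos⇒nonZero b
    b⁻¹ = 1/ b
    η   = b⁻¹ ℚ.* δ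
    0<η : 0ℚ ℚ.< η
    0<η = subst (ℚ._< η) (ℚ.*-zeroʳ b⁻¹) (ℚ.*-monoʳ-<-pos b⁻¹ {{ℚ.1/pos⇒pos b}} 0<δ)

  *-difference : ∀ a b c d → a ℚ.* b ℚ.- c ℚ.* d ≡ a ℚ.* (b ℚ.- d) ℚ.+ d ℚ.* (a ℚ.- c)
  *-difference = solve 4 (λ a b c d → a :* b :- c :* d := a :* (b :- d) :+ d :* (a :- c)) refl
    where open +-*-Solver

  *-cauchy : ∀ {s t} → IsCauchy s → IsCauchy t → IsCauchy (λ n → s n ℚ.* t n)
  *-cauchy {s} {t} cs ct δ 0<δ =
    let b , b>0 , N₁ , s≤b = bound {s} cs
        c , c>0 , N₂ , t≤c = bound {t} ct
        η , 0<η , b-small  = scale b {{b>0}} (half-pos 0<δ)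
        θ , 0<θ , c-small  = scale c {{c>0}} (half-pos 0<δ)
        N₃ , t-close       = ct η 0<η
        N₄ , s-close       = cs θ 0<θ
        A = N₁ ℕ.⊔ N₂
        B = N₃ ℕ.⊔ N₄
    in A ℕ.⊔ B , λ m n ≤m ≤n →
      let A≤m = ℕ.m⊔n≤o⇒m≤o A B ≤m ; B≤m = ℕ.m⊔n≤o⇒n≤o A B ≤m
          A≤n = ℕ.m⊔n≤o⇒m≤o A B ≤n ; B≤n = ℕ.m⊔n≤o⇒n≤o A B ≤n
      in begin-strict
      ∣ s m ℚ.* t m ℚ.- s n ℚ.* t n ∣
        ≡⟨ cong ∣_∣ (*-difference (s m) (t m) (s n) (t n)) ⟩
      ∣ s m ℚ.* (t m ℚ.- t n) ℚ.+ t n ℚ.* (s m ℚ.- s n) ∣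
        ≤⟨ ℚ.∣p+q∣≤∣p∣+∣q∣ (s m ℚ.* (t m ℚ.- t n)) (t n ℚ.* (s m ℚ.- s n)) ⟩
      ∣ s m ℚ.* (t m ℚ.- t n) ∣ ℚ.+ ∣ t n ℚ.* (s m ℚ.- s n) ∣
        <⟨ ℚ.+-mono-<
             (b-small (s m) (t m ℚ.- t n) (s≤b m (ℕ.m⊔n≤o⇒m≤o N₁ N₂ A≤m))
               (t-close m n (ℕ.m⊔n≤o⇒m≤o N₃ N₄ B≤m) (ℕ.m⊔n≤o⇒m≤o N₃ N₄ B≤n)))
             (c-small (t n) (s m ℚ.- s n) (t≤c n (ℕ.m⊔n≤o⇒n≤o N₁ N₂ A≤n))
               (s-close m n (ℕ.m⊔n≤o⇒n≤o N₃ N₄ B≤m) (ℕ.m⊔n≤o⇒n≤o N₃ N₄ B≤n))) ⟩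
      ½ ℚ.* δ ℚ.+ ½ ℚ.* δ  ≡⟨ halves δ ⟩
      δ                    ∎
    where open ℚ.≤-Reasoning

fromℚ : ℚ → ℝ
fromℚ q = mkℝ (λ _ → q) (const-cauchy q)

fromℕ : ℕ → ℝ
fromℕ k = fromℚ (+ k / 1)

0ʳ 1ʳ : ℝ
0ʳ = fromℚ 0ℚ
1ʳ = fromℚ 1ℚ

infixl 6 _+ʳ_ _-ʳ_
infixl 7 _*ʳ_
infix  8 -ʳ_
infixr 8 _^ʳ_

-ʳ_ : ℝ → ℝ
-ʳ mkℝ s cs = mkℝ (λ n → ℚ.- s n) (neg-cauchy {s} cs)

_+ʳ_ _*ʳ_ _-ʳ_ : ℝ → ℝ → ℝ
mkℝ s cs +ʳ mkℝ t ct = mkℝ (λ n → s n ℚ.+ t n) (+-cauchy {s} {t} cs ct)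
mkℝ s cs *ʳ mkℝ t ct = mkℝ (λ n → s n ℚ.* t n) (*-cauchy {s} {t} cs ct)
x -ʳ y = x +ʳ -ʳ y

_^ʳ_ : ℝ → ℕ → ℝ
x ^ʳ zero  = 1ʳ
x ^ʳ suc n = x *ʳ x ^ʳ n

record ℂ : Set where
  constructor _+i_
  field
    re im : ℝ
open ℂ public

infix 4 _≃ᶜ_

_≃ᶜ_ : ℂ → ℂ → Set
x ≃ᶜ y = re x ≃ʳ re y × im x ≃ʳ im y

0ᶜ 1ᶜ : ℂ
0ᶜ = 0ʳ +i 0ʳ
1ᶜ = 1ʳ +i 0ʳ

infixl 6 _+ᶜ_
infixl 7 _*ᶜ_

_+ᶜ_ _*ᶜ_ : ℂ → ℂ → ℂ
(a +i b) +ᶜ (c +i d) = (a +ʳ c) +i (b +ʳ d)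
(a +i b) *ᶜ (c +i d) = (a *ʳ c -ʳ b *ʳ d) +i (a *ʳ d +ʳ b *ʳ c)

conj : ℂ → ℂ
conj (a +i b) = a +i (-ʳ b)

∣_∣² : ℂ → ℝ
∣ a +i b ∣² = a *ʳ a +ʳ b *ʳ b

record Signature (o : Level) : Set (lsuc o) where
  field
    Symbol : Set o
    arity  : Symbol → ℕ
open Signature public

-- Algebra S X is the type of algebras of signature S with universe X.
Algebra : ∀ {x} → Signature o → Set x → Set (o ⊔ x)
Algebra S X = ∀ s → Vec X (arity S s) → X

infix 8 _^ᴬ_

_^ᴬ_ : ∀ {x} {X : Set x} {S : Signature o} → Algebra S X → ∀ n → Algebra S (Vec X n)
(B ^ᴬ n) s vs = tabulate λ i → B s (map (λ v → lookup v i) vs)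

IsHomomorphism : ∀ {x y} {X : Set x} {Y : Set y} {S : Signature o} →
                 Algebra S X → Algebra S Y → (X → Y) → Set (o ⊔ x ⊔ y)
IsHomomorphism A C φ = ∀ s vs → φ (A s vs) ≡ C s (map φ vs)

Ker : ∀ {x y} {X : Set x} {Y : Set y} → (X → Y) → X → X → Set y
Ker φ a b = φ a ≡ φ b

-- The universe {0,1} is Bool, with false for 0 and true for 1.

Operation : ℕ → Set
Operation k = Vec Bool k → Bool

OperationSet : (o : Level) → Set (lsuc o)
OperationSet o = ∀ {k} → Operation k → Set o

-- Without function extensionality, closure under pointwise equality
-- (resp) has to be imposed explicitly.
data ⟨_⟩ (F : OperationSet o) : {k : ℕ} → Operation k → Set o where
  gen  : ∀ {k} {f : Operation k} → F f → ⟨ F ⟩ f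
  proj : ∀ {k} (i : Fin k) → ⟨ F ⟩ (λ v → lookup v i)
  comp : ∀ {m k} {f : Operation m} {g : Fin m → Operation k} →
         ⟨ F ⟩ f → (∀ i → ⟨ F ⟩ (g i)) → ⟨ F ⟩ (λ v → f (tabulate λ i → g i v))
  resp : ∀ {k} {f g : Operation k} → f ≗ g → ⟨ F ⟩ f → ⟨ F ⟩ g

data Basic {S : Signature o} (B : Algebra S Bool) : {k : ℕ} → Operation k → Set o where
  basic : ∀ s → Basic B (B s)

Clo : {S : Signature o} → Algebra S Bool → OperationSet o
Clo B = ⟨ Basic B ⟩

infix 4 _≼_

_≼_ : ∀ {p} {S : Signature o} → Algebra S Bool → OperationSet p → Set (o ⊔ p)
B ≼ 𝒞 = ∀ {k} {f : Operation k} → Clo B f → 𝒞 f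

and or : Operation 2
and (x ∷ y ∷ []) = x ∧ y
or  (x ∷ y ∷ []) = x ∨ y

negation : Operation 1
negation (x ∷ []) = not x

constant : Bool → Operation 0
constant b [] = b

data ⋀-Generator : {k : ℕ} → Operation k → Set where
  meet : ⋀-Generator and
  zero : ⋀-Generator (constant false)
  one  : ⋀-Generator (constant true)

data ⋁-Generator : {k : ℕ} → Operation k → Set where
  join : ⋁-Generator or
  zero : ⋁-Generator (constant false)
  one  : ⋁-Generator (constant true)

data 𝖴-Generator : {k : ℕ} → Operation k → Set where
  neg  : 𝖴-Generator negation
  zero : 𝖴-Generator (constant false)

⋀ ⋁ 𝖴 : OperationSet 0ℓ
⋀ = ⟨ ⋀-Generator ⟩
⋁ = ⟨ ⋁-Generator ⟩
𝖴 = ⟨ 𝖴-Generator ⟩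

Bits : ℕ → Set
Bits = Vec Bool

_≟ᵇ_ : DecidableEquality (Bits n)
_≟ᵇ_ = Vec.≡-dec Bool._≟_

_⊕_ : Bits n → Bits n → Bits n
_⊕_ = zipWith _xor_

sumBits : ∀ {A : Set} → (A → A → A) → ∀ n → (Bits n → A) → A
sumBits _∙_ zero    f = f []
sumBits _∙_ (suc n) f = sumBits _∙_ n (f ∘ (false ∷_)) ∙ sumBits _∙_ n (f ∘ (true ∷_))

-- Computational basis of n + ℓ + w qubits: the oracle's argument
-- register, the oracle's answer register, and the workspace.
Basis : ℕ → ℕ → ℕ → Set
Basis n ℓ w = Bits n × Bits ℓ × Bits w

_≟_ : DecidableEquality (Basis n ℓ w)
_≟_ = Product.≡-dec _≟ᵇ_ (Product.≡-dec _≟ᵇ_ _≟ᵇ_)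

sum : ∀ {A : Set} → (A → A → A) → (Basis n ℓ w → A) → A
sum {n} {ℓ} {w} _∙_ f =
  sumBits _∙_ n λ a → sumBits _∙_ ℓ λ y → sumBits _∙_ w λ z → f (a , y , z)

State : ℕ → ℕ → ℕ → Set
State n ℓ w = Basis n ℓ w → ℂ

Matrix : ℕ → ℕ → ℕ → Set
Matrix n ℓ w = Basis n ℓ w → Basis n ℓ w → ℂ

ket : Basis n ℓ w → State n ℓ w
ket b b′ = if does (b ≟ b′) then 1ᶜ else 0ᶜ

𝟙 : Matrix n ℓ w
𝟙 i j = ket i j

_† : Matrix n ℓ w → Matrix n ℓ w
(M †) i j = conj (M j i)

_⊙_ : Matrix n ℓ w → Matrix n ℓ w → Matrix n ℓ w
(M ⊙ N) i j = sum _+ᶜ_ λ k → M i k *ᶜ N k j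

_·_ : Matrix n ℓ w → State n ℓ w → State n ℓ w
(M · ψ) i = sum _+ᶜ_ λ j → M i j *ᶜ ψ j

-- Opaque because checking a record with a field of this type would
-- otherwise normalise all the rational arithmetic in it.
opaque
  IsUnitary : Matrix n ℓ w → Set
  IsUnitary M = (∀ i j → ((M †) ⊙ M) i j ≃ᶜ 𝟙 i j) × (∀ i j → (M ⊙ (M †)) i j ≃ᶜ 𝟙 i j)

record Unitary (n ℓ w : ℕ) : Set where
  field
    matrix  : Matrix n ℓ w
    unitary : IsUnitary matrix
open Unitary public

-- The unitary |a , y , z⟩ ↦ |a , y ⊕ f a , z⟩, acting on amplitudes.
oracle : (Bits n → Bits ℓ) → State n ℓ w → State n ℓ w
oracle f ψ (a , y , z) = ψ (a , y ⊕ f a , z)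

-- A quantum algorithm with oracle access to a function Bits n → Bits ℓ
-- that outputs a binary relation on Bits n.  Starting from |0…0⟩ it
-- applies `initial`; then, for each entry V of `steps`, it makes one
-- oracle query and applies V.  Finally all qubits are measured, and
-- `output` is applied to the outcome.
record QueryAlgorithm (n ℓ : ℕ) : Set where
  field
    workspace : ℕ
    initial   : Unitary n ℓ workspace
    steps     : List (Unitary n ℓ workspace)
    output    : Basis n ℓ workspace → (Bits n → Bits n → Bool)
open QueryAlgorithm public

queries : QueryAlgorithm n ℓ → ℕ
queries = length ∘ steps

final : (𝒜 : QueryAlgorithm n ℓ) → (Bits n → Bits ℓ) → State n ℓ (workspace 𝒜)
final {n} {ℓ} 𝒜 f =
  foldl (λ ψ V → matrix V · oracle f ψ) (matrix (initial 𝒜) · ket 0⃗) (steps 𝒜)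
  where
  0⃗ = replicate n false , replicate ℓ false , replicate (workspace 𝒜) false

-- The probability that the output satisfies P when the oracle is f.
probability : (𝒜 : QueryAlgorithm n ℓ) → (Bits n → Bits ℓ) →
  {P : (Bits n → Bits n → Bool) → Set} → (∀ R → Dec (P R)) → ℝ
probability 𝒜 f P? =
  sum _+ʳ_ λ b → if does (P? (output 𝒜 b)) then ∣ final 𝒜 f b ∣² else 0ʳ

IsKernelOf : ∀ {X : Set} → (Bits n → X) → (Bits n → Bits n → Bool) → Set
IsKernelOf φ R = ∀ a b → R a b ≡ true ⇔ Ker φ a b

allBits? : ∀ n {P : Bits n → Set} → (∀ v → Dec (P v)) → Dec (∀ v → P v)
allBits? zero    P? = map′ (λ { p [] → p }) (λ p → p []) (P? [])
allBits? (suc n) P? =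
  map′ (λ { (p , q) (false ∷ v) → p v ; (p , q) (true ∷ v) → q v })
       (λ p → p ∘ (false ∷_) , p ∘ (true ∷_))
       (allBits? n (P? ∘ (false ∷_)) ×-dec allBits? n (P? ∘ (true ∷_)))

isKernelOf? : ∀ {X : Set} → DecidableEquality X → (φ : Bits n → X) →
              ∀ R → Dec (IsKernelOf φ R)
isKernelOf? {n} _≟ˣ_ φ R = allBits? n λ a → allBits? n λ b →
  let R? = R a b Bool.≟ true ; K? = φ a ≟ˣ φ b in
  map′ (λ (p , q) → mk⇔ p q) (λ e → Equivalence.to e , Equivalence.from e)
       ((R? →-dec K?) ×-dec (K? →-dec R?))

-- The algorithm knows only the number ℓ of bits used to label the
-- elements of the target algebra.
HKPAlgorithm : ℕ → Set
HKPAlgorithm n = ∀ ℓ → QueryAlgorithm n ℓ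

infix 4 _SolvesHKP_

-- The oracle returns ℓ-bit labels of the values of φ.  The target
-- algebra C, its labelling and φ are quantified after the algorithm is
-- fixed, so it learns about them through the oracle only.
-- Solving means succeeding with probability at least 2/3 on every input.
_SolvesHKP_ : {S : Signature o} → HKPAlgorithm n → Algebra S (Bits n) → Set (o ⊔ lsuc 0ℓ)
_SolvesHKP_ {S = S} 𝒜 A =
  ∀ ℓ {X : Set} (C : Algebra S X) (label : X ↣ Bits ℓ) φ → IsHomomorphism A C φ →
  fromℚ (+ 2 / 3) ≤ʳ
    probability (𝒜 ℓ) (Injection.to label ∘ φ) (isKernelOf? (via-injection label _≟ᵇ_) φ)

{-# OPTIONS --safe #-}

-- Fix a set I of vectors v such that f(v₁,…,v_k) ∈ I as soon as some v_j ∈ I, for the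
-- generators f of the clone.  Identifying true ∷ v with false ∷ v for v ∈ I is then a
-- congruence of Bᵐ⁺¹.  For ⋀ (⋁) one may take the vectors below (above) a layer of the cube
-- together with any part of that layer, for 𝖴 any union of pairs {v , ¬ v}.  So there are
-- 2^N such congruences with N ≥ 2ᵐ/(m+1), and each oracle answer reveals one of N bits.
-- An algorithm finding the kernel finds the parity of these N bits.  After T queries the
-- amplitudes are polynomials of degree at most T in the bits, so the probabilities have
-- degree at most 2T; since a polynomial of degree less than N is orthogonal to the
-- parity, N ≤ 2T.
module Submission where

open import Defs
open import Data.Bool.Base using (Bool)
open import Data.Nat.Base using (ℕ; _≤_)
open import Data.Product.Base using (∃-syntax; _×_)
open import Data.Sum.Base using (_⊎_)

open import Algebra.Bundles using (CommutativeRing)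
open import Algebra.Structures using (IsAbelianGroup; IsCommutativeRing; IsMonoid)
open import Data.Bool.Base using (true; false; if_then_else_; not; _∧_; _∨_)
import Data.Bool.Properties as Bool
open import Data.Fin.Base using (Fin; zero; suc)
open import Data.Integer.Base as ℤ using (+_)
import Data.Integer.Properties as ℤ
open import Data.List.Base as List using (List; []; _∷_; filter; foldl; length)
open import Data.List.Membership.Propositional using (_∈_)
open import Data.List.Membership.Propositional.Properties using (∈-filter⁻; ∈-map⁻)
import Data.List.Properties as List
open import Data.List.Relation.Binary.Sublist.Propositional.Properties using (filter⁺; filter-⊆; length-mono-≤)
open import Data.List.Relation.Unary.All as All using (All; []; _∷_)
import Data.List.Relation.Unary.All.Properties as All
open import Data.List.Relation.Unary.AllPairs using ([]; _∷_)
open import Data.List.Relation.Unary.Any using (here; there)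
open import Data.List.Relation.Unary.Unique.Propositional using (Unique)
import Data.List.Relation.Unary.Unique.Propositional.Properties as Unique
open import Data.Nat.Base as ℕ using (zero; suc)
open import Data.Nat.Coprimality using (1-coprimeTo) renaming (sym to coprime-sym)
import Data.Nat.Properties as ℕ
open import Data.Nat.Solver using () renaming (module +-*-Solver to ℕ-Solver)
open import Data.Product.Base using (_,_; proj₁; proj₂)
open import Data.Rational.Base as ℚ using (ℚ; mkℚ; 0ℚ; 1ℚ; ½; _/_; 1/_; ∣_∣)
import Data.Rational.Properties as ℚ
open import Data.Rational.Solver using (module +-*-Solver)
open import Data.Sum.Base using (inj₁; inj₂; [_,_]′)
open import Data.Vec.Base using (Vec; []; _∷_; count; lookup; map; replicate; tabulate; tail)
import Data.Vec.Properties as Vec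
open import Function.Base using (_∘_; _$_; case_of_)
open import Function.Bundles using (Equivalence; Injection; _↣_)
open import Function.Construct.Identity using (↣-id)
open import Level using (Level; 0ℓ)
open import Relation.Binary.PropositionalEquality
  using (_≡_; _≢_; _≗_; refl; sym; trans; cong; cong₂; subst; subst₂; module ≡-Reasoning)
open import Relation.Nullary.Decidable using (Dec; does; yes; no; dec-true; dec-false; via-injection)
open import Relation.Nullary.Negation using (¬_; contradiction)

-- Parity serves because every polynomial of low degree is orthogonal to it, so a constant advantage
-- already contradicts few queries: success probability 2/3 leaves a signed expectation of at least
-- 1/3 for each choice of the bits, and with the signs of the parity these numbers add up without
-- cancellation. Polynomials are not written with coefficients. A degree is certified by finite
-- differences, and the correlation with the parity is the iterated difference in all the bits, so
-- each bit uses up one degree. The count gives `2^n ≤ 4nT`, which loses a factor linear in `n`. The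
-- gap `δ` between `ε` and 1 pays for it: `(1 + ε)(1 + δ/2) ≤ 2`, hence by Bernoulli's inequality
-- `(1 + ε)^n (1 + nδ/2) ≤ 2^n`, and the factor `n` cancels. Such estimates are made on single terms
-- of the Cauchy sequences, where they are inequalities between rationals.

private
  variable
    o p : Level
    A B C K : Set
    P Q : ℕ → Set
    s t : ℕ → ℚ
    d e k ℓ m n w N : ℕ

-- The ring of complex numbers

eventually-∧ : Eventually P → Eventually Q → Eventually (λ n → P n × Q n)
eventually-∧ (N , p) (M , q) = N ℕ.⊔ M , λ n ≤n →
  p n (ℕ.m⊔n≤o⇒m≤o N M ≤n) , q n (ℕ.m⊔n≤o⇒n≤o N M ≤n)

eventually-map : (∀ n → P n → Q n) → Eventually P → Eventually Q
eventually-map f (N , p) = N , λ n N≤n → f n (p n N≤n)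

half-pos : ∀ {δ} → 0ℚ ℚ.< δ → 0ℚ ℚ.< ½ ℚ.* δ
half-pos = ℚ.*-monoʳ-<-pos ½

halves : ∀ δ → ½ ℚ.* δ ℚ.+ ½ ℚ.* δ ≡ δ
halves δ = trans (sym (ℚ.*-distribʳ-+ δ ½ ½)) (ℚ.*-identityˡ δ)

-- `x ≃ʳ y` unfolds to nullity of the difference of the two sequences, so congruence of the real
-- operations reduces to closure properties of null sequences.
Null : (ℕ → ℚ) → Set
Null s = ∀ δ → 0ℚ ℚ.< δ → Eventually λ n → ∣ s n ∣ ℚ.< δ

null-resp : (∀ n → s n ≡ t n) → Null s → Null t
null-resp s≡t ns δ 0<δ =
  eventually-map (λ n → subst (λ q → ∣ q ∣ ℚ.< δ) (s≡t n)) (ns δ 0<δ)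

null-0 : Null (λ _ → 0ℚ)
null-0 δ 0<δ = 0 , λ _ _ → 0<δ

null-+ : Null s → Null t → Null (λ n → s n ℚ.+ t n)
null-+ {s} {t} ns nt δ 0<δ =
  eventually-map small (eventually-∧ (ns _ (half-pos 0<δ)) (nt _ (half-pos 0<δ)))
  where
  open ℚ.≤-Reasoning
  small : ∀ n → ∣ s n ∣ ℚ.< ½ ℚ.* δ × ∣ t n ∣ ℚ.< ½ ℚ.* δ → ∣ s n ℚ.+ t n ∣ ℚ.< δ
  small n (s< , t<) = begin-strict
    ∣ s n ℚ.+ t n ∣          ≤⟨ ℚ.∣p+q∣≤∣p∣+∣q∣ (s n) (t n) ⟩
    ∣ s n ∣ ℚ.+ ∣ t n ∣      <⟨ ℚ.+-mono-< s< t< ⟩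
    ½ ℚ.* δ ℚ.+ ½ ℚ.* δ      ≡⟨ halves δ ⟩
    δ                        ∎

null-neg : Null s → Null (λ n → ℚ.- s n)
null-neg {s} ns δ 0<δ =
  eventually-map (λ n → subst (ℚ._< δ) (sym (ℚ.∣-p∣≡∣p∣ (s n)))) (ns δ 0<δ)

cauchy-bounded : IsCauchy s → ∃[ b ] ℚ.Positive b × Eventually λ n → ∣ s n ∣ ℚ.≤ b
cauchy-bounded {s} cs with cs 1ℚ (ℚ.positive⁻¹ 1ℚ)
... | N , close = 1ℚ ℚ.+ ∣ s N ∣
  , ℚ.pos+nonNeg⇒pos 1ℚ ∣ s N ∣ {{ℚ.∣-∣-nonNeg (s N)}}
  , N , λ n N≤n → begin
  ∣ s n ∣                        ≡⟨ cong ∣_∣ (solve 2 (λ a b → a := (a :- b) :+ b) refl (s n) (s N)) ⟩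
  ∣ (s n ℚ.- s N) ℚ.+ s N ∣      ≤⟨ ℚ.∣p+q∣≤∣p∣+∣q∣ (s n ℚ.- s N) (s N) ⟩
  ∣ s n ℚ.- s N ∣ ℚ.+ ∣ s N ∣    ≤⟨ ℚ.+-monoˡ-≤ ∣ s N ∣ (ℚ.<⇒≤ (close n N N≤n ℕ.≤-refl)) ⟩
  1ℚ ℚ.+ ∣ s N ∣                 ∎
  where open ℚ.≤-Reasoning
        open +-*-Solver

scale : ∀ b → .{{ℚ.Positive b}} → ∀ {δ} → 0ℚ ℚ.< δ →
  ∃[ η ] 0ℚ ℚ.< η × (∀ p q → ∣ p ∣ ℚ.≤ b → ∣ q ∣ ℚ.< η → ∣ p ℚ.* q ∣ ℚ.< δ)
scale b {δ} 0<δ = η , 0<η , λ p q p≤b q<η → begin-strict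
  ∣ p ℚ.* q ∣        ≡⟨ ℚ.∣p*q∣≡∣p∣*∣q∣ p q ⟩
  ∣ p ∣ ℚ.* ∣ q ∣    ≤⟨ ℚ.*-monoʳ-≤-nonNeg ∣ q ∣ {{ℚ.∣-∣-nonNeg q}} p≤b ⟩
  b ℚ.* ∣ q ∣        <⟨ ℚ.*-monoʳ-<-pos b q<η ⟩
  b ℚ.* (b⁻¹ ℚ.* δ)  ≡⟨ sym (ℚ.*-assoc b b⁻¹ δ) ⟩
  (b ℚ.* b⁻¹) ℚ.* δ  ≡⟨ cong (ℚ._* δ) (ℚ.*-inverseʳ b) ⟩
  1ℚ ℚ.* δ           ≡⟨ ℚ.*-identityˡ δ ⟩
  δ                  ∎
  where
  open ℚ.≤-Reasoning
  instance
    b≢0 : ℚ.NonZero b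
    b≢0 = ℚ.pos⇒nonZero b
  b⁻¹ = 1/ b
  η   = b⁻¹ ℚ.* δ
  0<η : 0ℚ ℚ.< η
  0<η = subst (ℚ._< η) (ℚ.*-zeroʳ b⁻¹) (ℚ.*-monoʳ-<-pos b⁻¹ {{ℚ.1/pos⇒pos b}} 0<δ)

null-* : IsCauchy s → Null t → Null (λ n → s n ℚ.* t n)
null-* {s} {t} cs nt δ 0<δ =
  let b , b>0 , s≤b = cauchy-bounded {s} cs
      η , 0<η , small = scale b {{b>0}} 0<δ
  in eventually-map (λ n (s≤ , t<) → small (s n) (t n) s≤ t<) (eventually-∧ s≤b (nt η 0<η))

-- Ring laws hold already between the terms of the sequences; this turns each of them into an
-- identity in ℚ.
≗⇒≃ʳ : ∀ {x y} → (∀ n → seq x n ≡ seq y n) → x ≃ʳ y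
≗⇒≃ʳ {x} {y} x≗y =
  null-resp (λ n → sym (trans (cong (ℚ._- seq y n) (x≗y n)) (ℚ.+-inverseʳ (seq y n)))) null-0

≃ʳ-refl : ∀ {x} → x ≃ʳ x
≃ʳ-refl {x} = ≗⇒≃ʳ {x} {x} λ _ → refl

≃ʳ-sym : ∀ {x y} → x ≃ʳ y → y ≃ʳ x
≃ʳ-sym {x} {y} x≃y =
  null-resp (λ n → solve 2 (λ a b → :- (a :- b) := b :- a) refl (seq x n) (seq y n)) (null-neg x≃y)
  where open +-*-Solver

≃ʳ-trans : ∀ {x y z} → x ≃ʳ y → y ≃ʳ z → x ≃ʳ z
≃ʳ-trans {x} {y} {z} x≃y y≃z =
  null-resp (λ n → solve 3 (λ a b c → (a :- b) :+ (b :- c) := a :- c) refl (seq x n) (seq y n) (seq z n))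
    (null-+ x≃y y≃z)
  where open +-*-Solver

+ʳ-cong : ∀ {x y u v} → x ≃ʳ y → u ≃ʳ v → x +ʳ u ≃ʳ y +ʳ v
+ʳ-cong {x} {y} {u} {v} x≃y u≃v =
  null-resp (λ n → solve 4 (λ a b c d → (a :- b) :+ (c :- d) := (a :+ c) :- (b :+ d)) refl
                     (seq x n) (seq y n) (seq u n) (seq v n))
    (null-+ x≃y u≃v)
  where open +-*-Solver

-ʳ-cong : ∀ {x y} → x ≃ʳ y → -ʳ x ≃ʳ -ʳ y
-ʳ-cong {x} {y} x≃y =
  null-resp (λ n → ℚ.neg-distrib-+ (seq x n) (ℚ.- seq y n)) (null-neg x≃y)

*ʳ-cong : ∀ {x y u v} → x ≃ʳ y → u ≃ʳ v → x *ʳ u ≃ʳ y *ʳ v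
*ʳ-cong {x} {y} {u} {v} x≃y u≃v =
  null-resp (λ n → solve 4 (λ a b c d → a :* (c :- d) :+ d :* (a :- b) := a :* c :- b :* d) refl
                     (seq x n) (seq y n) (seq u n) (seq v n))
    (null-+ {λ n → seq x n ℚ.* (seq u n ℚ.- seq v n)} {λ n → seq v n ℚ.* (seq x n ℚ.- seq y n)}
      (null-* {seq x} {λ n → seq u n ℚ.- seq v n} (cauchy x) u≃v)
      (null-* {seq v} {λ n → seq x n ℚ.- seq y n} (cauchy v) x≃y))
  where open +-*-Solver

-ᶜ_ : ℂ → ℂ
-ᶜ (a +i b) = (-ʳ a) +i (-ʳ b)

-- A wrapper that keeps unification from unfolding _≃ᶜ_.
infix 4 _≈ᶜ_
record _≈ᶜ_ (x y : ℂ) : Set where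
  constructor equal
  field
    re-≃ : re x ≃ʳ re y
    im-≃ : im x ≃ʳ im y
open _≈ᶜ_

≗⇒≈ᶜ : ∀ {x y} → (∀ n → seq (re x) n ≡ seq (re y) n) → (∀ n → seq (im x) n ≡ seq (im y) n) → x ≈ᶜ y
≗⇒≈ᶜ {x} {y} r i = equal (≗⇒≃ʳ {re x} {re y} r) (≗⇒≃ʳ {im x} {im y} i)

module _ where
  open +-*-Solver

  *ᶜ-assoc : ∀ x y z → (x *ᶜ y) *ᶜ z ≈ᶜ x *ᶜ (y *ᶜ z)
  *ᶜ-assoc x y z = ≗⇒≈ᶜ
    (λ n → solve 6 (λ a b c d e f →
        (a :* c :+ :- (b :* d)) :* e :+ :- ((a :* d :+ b :* c) :* f) :=
        a :* (c :* e :+ :- (d :* f)) :+ :- (b :* (c :* f :+ d :* e))) refl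
      (seq (re x) n) (seq (im x) n) (seq (re y) n) (seq (im y) n) (seq (re z) n) (seq (im z) n))
    (λ n → solve 6 (λ a b c d e f →
        (a :* c :+ :- (b :* d)) :* f :+ (a :* d :+ b :* c) :* e :=
        a :* (c :* f :+ d :* e) :+ b :* (c :* e :+ :- (d :* f))) refl
      (seq (re x) n) (seq (im x) n) (seq (re y) n) (seq (im y) n) (seq (re z) n) (seq (im z) n))

  *ᶜ-comm : ∀ x y → x *ᶜ y ≈ᶜ y *ᶜ x
  *ᶜ-comm x y = ≗⇒≈ᶜ
    (λ n → solve 4 (λ a b c d → a :* c :+ :- (b :* d) := c :* a :+ :- (d :* b)) refl
      (seq (re x) n) (seq (im x) n) (seq (re y) n) (seq (im y) n))
    (λ n → solve 4 (λ a b c d → a :* d :+ b :* c := c :* b :+ d :* a) refl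
      (seq (re x) n) (seq (im x) n) (seq (re y) n) (seq (im y) n))

  *ᶜ-identityˡ : ∀ x → 1ᶜ *ᶜ x ≈ᶜ x
  *ᶜ-identityˡ x = ≗⇒≈ᶜ
    (λ n → solve 2 (λ a b → con 1ℚ :* a :+ :- (con 0ℚ :* b) := a) refl (seq (re x) n) (seq (im x) n))
    (λ n → solve 2 (λ a b → con 1ℚ :* b :+ con 0ℚ :* a := b) refl (seq (re x) n) (seq (im x) n))

  *ᶜ-distribˡ-+ᶜ : ∀ x y z → x *ᶜ (y +ᶜ z) ≈ᶜ x *ᶜ y +ᶜ x *ᶜ z
  *ᶜ-distribˡ-+ᶜ x y z = ≗⇒≈ᶜ
    (λ n → solve 6 (λ a b c d e f →
        a :* (c :+ e) :+ :- (b :* (d :+ f)) := (a :* c :+ :- (b :* d)) :+ (a :* e :+ :- (b :* f))) refl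
      (seq (re x) n) (seq (im x) n) (seq (re y) n) (seq (im y) n) (seq (re z) n) (seq (im z) n))
    (λ n → solve 6 (λ a b c d e f →
        a :* (d :+ f) :+ b :* (c :+ e) := (a :* d :+ b :* c) :+ (a :* f :+ b :* e)) refl
      (seq (re x) n) (seq (im x) n) (seq (re y) n) (seq (im y) n) (seq (re z) n) (seq (im z) n))

≈ᶜ-refl : ∀ {x} → x ≈ᶜ x
≈ᶜ-refl {x} = equal (≃ʳ-refl {re x}) (≃ʳ-refl {im x})

≈ᶜ-sym : ∀ {x y} → x ≈ᶜ y → y ≈ᶜ x
≈ᶜ-sym {x} {y} (equal r i) = equal (≃ʳ-sym {re x} {re y} r) (≃ʳ-sym {im x} {im y} i)

≈ᶜ-trans : ∀ {x y z} → x ≈ᶜ y → y ≈ᶜ z → x ≈ᶜ z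
≈ᶜ-trans {x} {y} {z} (equal r i) (equal r′ i′) =
  equal (≃ʳ-trans {re x} {re y} {re z} r r′) (≃ʳ-trans {im x} {im y} {im z} i i′)

+ᶜ-cong : ∀ {x y u v} → x ≈ᶜ y → u ≈ᶜ v → x +ᶜ u ≈ᶜ y +ᶜ v
+ᶜ-cong {x} {y} {u} {v} (equal r i) (equal r′ i′) =
  equal (+ʳ-cong {re x} {re y} {re u} {re v} r r′) (+ʳ-cong {im x} {im y} {im u} {im v} i i′)

*ᶜ-cong : ∀ {x y u v} → x ≈ᶜ y → u ≈ᶜ v → x *ᶜ u ≈ᶜ y *ᶜ v
*ᶜ-cong {a +i b} {a′ +i b′} {c +i d} {c′ +i d′} (equal a≃ b≃) (equal c≃ d≃) = equal
  (+ʳ-cong {a *ʳ c} {a′ *ʳ c′} { -ʳ (b *ʳ d)} { -ʳ (b′ *ʳ d′)}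
    (*ʳ-cong {a} {a′} {c} {c′} a≃ c≃)
    (-ʳ-cong {b *ʳ d} {b′ *ʳ d′} (*ʳ-cong {b} {b′} {d} {d′} b≃ d≃)))
  (+ʳ-cong {a *ʳ d} {a′ *ʳ d′} {b *ʳ c} {b′ *ʳ c′}
    (*ʳ-cong {a} {a′} {d} {d′} a≃ d≃) (*ʳ-cong {b} {b′} {c} {c′} b≃ c≃))

+ᶜ-assoc : ∀ x y z → (x +ᶜ y) +ᶜ z ≈ᶜ x +ᶜ (y +ᶜ z)
+ᶜ-assoc x y z = ≗⇒≈ᶜ
  (λ n → ℚ.+-assoc (seq (re x) n) (seq (re y) n) (seq (re z) n))
  (λ n → ℚ.+-assoc (seq (im x) n) (seq (im y) n) (seq (im z) n))

+ᶜ-comm : ∀ x y → x +ᶜ y ≈ᶜ y +ᶜ x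
+ᶜ-comm x y = ≗⇒≈ᶜ
  (λ n → ℚ.+-comm (seq (re x) n) (seq (re y) n)) (λ n → ℚ.+-comm (seq (im x) n) (seq (im y) n))

+ᶜ-identityˡ : ∀ x → 0ᶜ +ᶜ x ≈ᶜ x
+ᶜ-identityˡ x = ≗⇒≈ᶜ (λ n → ℚ.+-identityˡ (seq (re x) n)) (λ n → ℚ.+-identityˡ (seq (im x) n))

+ᶜ-inverseˡ : ∀ x → (-ᶜ x) +ᶜ x ≈ᶜ 0ᶜ
+ᶜ-inverseˡ x = ≗⇒≈ᶜ (λ n → ℚ.+-inverseˡ (seq (re x) n)) (λ n → ℚ.+-inverseˡ (seq (im x) n))

-ᶜ-cong : ∀ {x y} → x ≈ᶜ y → -ᶜ x ≈ᶜ -ᶜ y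
-ᶜ-cong {x} {y} (equal r i) = equal (-ʳ-cong {re x} {re y} r) (-ʳ-cong {im x} {im y} i)

+ᶜ-isMonoid : IsMonoid _≈ᶜ_ _+ᶜ_ 0ᶜ
+ᶜ-isMonoid = record
  { isSemigroup = record
    { isMagma = record
      { isEquivalence = record { refl = ≈ᶜ-refl ; sym = ≈ᶜ-sym ; trans = ≈ᶜ-trans }
      ; ∙-cong = +ᶜ-cong }
    ; assoc = +ᶜ-assoc }
  ; identity = +ᶜ-identityˡ , λ x → ≈ᶜ-trans (+ᶜ-comm x 0ᶜ) (+ᶜ-identityˡ x) }

+ᶜ-isAbelianGroup : IsAbelianGroup _≈ᶜ_ _+ᶜ_ 0ᶜ -ᶜ_
+ᶜ-isAbelianGroup = record
  { isGroup = record
    { isMonoid = +ᶜ-isMonoid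
    ; inverse = +ᶜ-inverseˡ , λ x → ≈ᶜ-trans (+ᶜ-comm x (-ᶜ x)) (+ᶜ-inverseˡ x)
    ; ⁻¹-cong = -ᶜ-cong }
  ; comm = +ᶜ-comm }

*ᶜ-distribʳ-+ᶜ : ∀ x y z → (y +ᶜ z) *ᶜ x ≈ᶜ y *ᶜ x +ᶜ z *ᶜ x
*ᶜ-distribʳ-+ᶜ x y z = ≈ᶜ-trans (*ᶜ-comm (y +ᶜ z) x)
  (≈ᶜ-trans (*ᶜ-distribˡ-+ᶜ x y z)
    (+ᶜ-cong {x *ᶜ y} {y *ᶜ x} {x *ᶜ z} {z *ᶜ x} (*ᶜ-comm x y) (*ᶜ-comm x z)))

ℂ-isCommutativeRing : IsCommutativeRing _≈ᶜ_ _+ᶜ_ _*ᶜ_ -ᶜ_ 0ᶜ 1ᶜ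
ℂ-isCommutativeRing = record
  { isRing = record
    { +-isAbelianGroup = +ᶜ-isAbelianGroup
    ; *-cong = *ᶜ-cong
    ; *-assoc = *ᶜ-assoc
    ; *-identity = *ᶜ-identityˡ , λ x → ≈ᶜ-trans (*ᶜ-comm x 1ᶜ) (*ᶜ-identityˡ x)
    ; distrib = *ᶜ-distribˡ-+ᶜ , *ᶜ-distribʳ-+ᶜ }
  ; *-comm = *ᶜ-comm }

ℂ-commutativeRing : CommutativeRing 0ℓ 0ℓ
ℂ-commutativeRing = record { isCommutativeRing = ℂ-isCommutativeRing }

-- Finite sums and polynomials in bits

-- The property is one of families in a parameter `k`: in the application `k` is the string of
-- unknown bits and the property is `Degree<`.
sumBits-closed : (_∙_ : A → A → A) (P : (K → A) → Set) →
  (∀ {F G} → P F → P G → P (λ k → F k ∙ G k)) →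
  ∀ n (f : K → Bits n → A) → (∀ b → P (λ k → f k b)) → P (λ k → sumBits _∙_ n (f k))
sumBits-closed _∙_ P cl zero    f p = p []
sumBits-closed _∙_ P cl (suc n) f p =
  cl (sumBits-closed _∙_ P cl n (λ k → f k ∘ (false ∷_)) (p ∘ (false ∷_)))
     (sumBits-closed _∙_ P cl n (λ k → f k ∘ (true ∷_)) (p ∘ (true ∷_)))

sum-closed : (_∙_ : A → A → A) (P : (K → A) → Set) →
  (∀ {F G} → P F → P G → P (λ k → F k ∙ G k)) →
  (f : K → Basis n ℓ w → A) → (∀ b → P (λ k → f k b)) → P (λ k → sum _∙_ (f k))
sum-closed {n = n} {ℓ} {w} _∙_ P cl f p =
  sumBits-closed _∙_ P cl n _ λ a → sumBits-closed _∙_ P cl ℓ _ λ y →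
  sumBits-closed _∙_ P cl w _ λ z → p (a , y , z)

module _ (_∙_ : A → A → A) (_∘′_ : B → B → B) (_⋆_ : C → C → C) (R : A → B → C → Set)
  (cl : ∀ {a a′ b b′ c c′} → R a b c → R a′ b′ c′ → R (a ∙ a′) (b ∘′ b′) (c ⋆ c′)) where

  sumBits-related₃ : ∀ n {f g h} → (∀ b → R (f b) (g b) (h b)) →
    R (sumBits _∙_ n f) (sumBits _∘′_ n g) (sumBits _⋆_ n h)
  sumBits-related₃ zero    r = r []
  sumBits-related₃ (suc n) r =
    cl (sumBits-related₃ n (r ∘ (false ∷_))) (sumBits-related₃ n (r ∘ (true ∷_)))

  -- Three sums over possibly different carriers are needed to compare the signed expectation, the
  -- success probability and the norm; additivity of sums is another instance.
  sum-related₃ : ∀ {f g h} → (∀ (b : Basis n ℓ w) → R (f b) (g b) (h b)) →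
    R (sum _∙_ f) (sum _∘′_ g) (sum _⋆_ h)
  sum-related₃ {n = n} {ℓ} {w} r =
    sumBits-related₃ n λ a → sumBits-related₃ ℓ λ y → sumBits-related₃ w λ z → r (a , y , z)

module _ (_∙_ : A → A → A) (_∘′_ : B → B → B) (R : A → B → Set)
  (cl : ∀ {a a′ b b′} → R a b → R a′ b′ → R (a ∙ a′) (b ∘′ b′)) where

  sumBits-related : ∀ n {f g} → (∀ b → R (f b) (g b)) → R (sumBits _∙_ n f) (sumBits _∘′_ n g)
  sumBits-related n {f} {g} = sumBits-related₃ _∙_ _∘′_ _∘′_ (λ a b _ → R a b) cl n {f} {g} {g}

  sum-related : ∀ {f g} → (∀ (b : Basis n ℓ w) → R (f b) (g b)) → R (sum _∙_ f) (sum _∘′_ g)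
  sum-related {f = f} {g} = sum-related₃ _∙_ _∘′_ _∘′_ (λ a b _ → R a b) cl {f = f} {g} {g}

-- The characteristic function of the subset of `L` selected by the bits `x`.
value : (L : List (Bits n)) → Bits (length L) → Bits n → Bool
value []      []      v = false
value (k ∷ L) (b ∷ x) v = if does (v ≟ᵇ k) then b else value L x v

module RingSums (R : CommutativeRing 0ℓ 0ℓ) where
  open CommutativeRing R hiding (zero)
    renaming (Carrier to 𝕂; refl to ≈-refl; sym to ≈-sym; trans to ≈-trans)
  open import Relation.Binary.Reasoning.Setoid setoid
  open import Algebra.Properties.CommutativeSemigroup +-commutativeSemigroup using (interchange)

  Additive : (𝕂 → 𝕂) → Set
  Additive h = ∀ a b → h (a + b) ≈ h a + h b

  sumBits-cong : ∀ n {f g : Bits n → 𝕂} → (∀ b → f b ≈ g b) → sumBits _+_ n f ≈ sumBits _+_ n g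
  sumBits-cong = sumBits-related _+_ _+_ _≈_ +-cong

  module _ (Φ : (K → 𝕂) → 𝕂) (Φ-+ : ∀ f g → Φ (λ k → f k + g k) ≈ Φ f + Φ g) where

    -- `Φ` stands for an outer sum. Since only its additivity matters, interchanging two sums takes
    -- one induction, on the inner one.
    sumBits-swap : ∀ n (f : K → Bits n → 𝕂) →
      Φ (λ k → sumBits _+_ n (f k)) ≈ sumBits _+_ n (λ b → Φ (λ k → f k b))
    sumBits-swap zero    f = ≈-refl
    sumBits-swap (suc n) f = ≈-trans (Φ-+ _ _) (+-cong (sumBits-swap n _) (sumBits-swap n _))

  sumBits-0 : ∀ n {f : Bits n → 𝕂} → (∀ b → f b ≈ 0#) → sumBits _+_ n f ≈ 0#
  sumBits-0 zero    f≈0 = f≈0 []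
  sumBits-0 (suc n) f≈0 =
    ≈-trans (+-cong (sumBits-0 n (f≈0 ∘ (false ∷_))) (sumBits-0 n (f≈0 ∘ (true ∷_)))) (+-identityˡ 0#)

  sumBits-single : ∀ n (c : Bits n) {f : Bits n → 𝕂} → (∀ b → b ≢ c → f b ≈ 0#) → sumBits _+_ n f ≈ f c
  sumBits-single zero    []          f≈0 = ≈-refl
  sumBits-single (suc n) (false ∷ c) f≈0 =
    ≈-trans (+-cong (sumBits-single n c λ b b≢c → f≈0 _ λ { refl → b≢c refl })
                  (sumBits-0 n λ b → f≈0 _ λ ()))
          (+-identityʳ _)
  sumBits-single (suc n) (true ∷ c)  f≈0 =
    ≈-trans (+-cong (sumBits-0 n λ b → f≈0 _ λ ())
                  (sumBits-single n c λ b b≢c → f≈0 _ λ { refl → b≢c refl }))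
          (+-identityˡ _)

  -- Adding `c` permutes the cube: a true bit of `c` exchanges the two halves. This makes an oracle
  -- query an isometry.
  sumBits-⊕ : ∀ n (c : Bits n) (f : Bits n → 𝕂) → sumBits _+_ n (λ b → f (b ⊕ c)) ≈ sumBits _+_ n f
  sumBits-⊕ zero    []          f = ≈-refl
  sumBits-⊕ (suc n) (false ∷ c) f = +-cong (sumBits-⊕ n c _) (sumBits-⊕ n c _)
  sumBits-⊕ (suc n) (true ∷ c)  f =
    ≈-trans (+-cong (sumBits-⊕ n c (f ∘ (true ∷_))) (sumBits-⊕ n c (f ∘ (false ∷_)))) (+-comm _ _)

  indicator : Bool → 𝕂
  indicator b = if b then 1# else 0#

  module BasisSums (n ℓ w : ℕ) where

    sum-cong : ∀ {f g : Basis n ℓ w → 𝕂} → (∀ b → f b ≈ g b) → sum _+_ f ≈ sum _+_ g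
    sum-cong {f} {g} = sum-related _+_ _+_ _≈_ +-cong {f = f} {g}

    additive-sum : ∀ {h} → Additive h → ∀ (f : Basis n ℓ w → 𝕂) → h (sum _+_ f) ≈ sum _+_ (h ∘ f)
    additive-sum {h} add f =
      sum-related _+_ _+_ (λ a b → h a ≈ b) (λ p q → ≈-trans (add _ _) (+-cong p q)) {f = f} {h ∘ f} (λ _ → ≈-refl)

    sum-*ˡ : ∀ c (f : Basis n ℓ w → 𝕂) → c * sum _+_ f ≈ sum _+_ (λ b → c * f b)
    sum-*ˡ c = additive-sum (distribˡ c)

    sum-*ʳ : ∀ c (f : Basis n ℓ w → 𝕂) → sum _+_ f * c ≈ sum _+_ (λ b → f b * c)
    sum-*ʳ c = additive-sum (distribʳ c)

    sum-+ : ∀ (f g : Basis n ℓ w → 𝕂) → sum _+_ (λ b → f b + g b) ≈ sum _+_ f + sum _+_ g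
    sum-+ f g = sum-related₃ _+_ _+_ _+_ (λ a b c → c ≈ a + b)
      (λ p q → ≈-trans (+-cong p q) (interchange _ _ _ _)) {f = f} {g} {λ b → f b + g b} (λ _ → ≈-refl)

    sum-swap : (Φ : (K → 𝕂) → 𝕂) → (∀ f g → Φ (λ k → f k + g k) ≈ Φ f + Φ g) →
      ∀ (f : K → Basis n ℓ w → 𝕂) → Φ (λ k → sum _+_ (f k)) ≈ sum _+_ (λ b → Φ (λ k → f k b))
    sum-swap Φ Φ-+ f =
      ≈-trans (sumBits-swap Φ Φ-+ n _) $ sumBits-cong n λ a →
      ≈-trans (sumBits-swap Φ Φ-+ ℓ _) $ sumBits-cong ℓ λ y →
      sumBits-swap Φ Φ-+ w _

    sum-single : ∀ (c : Basis n ℓ w) {f : Basis n ℓ w → 𝕂} → (∀ b → b ≢ c → f b ≈ 0#) → sum _+_ f ≈ f c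
    sum-single (a , y , z) f≈0 =
      ≈-trans (sumBits-single n a λ a′ ≢a → sumBits-0 ℓ λ y′ → sumBits-0 w λ z′ → f≈0 _ (≢a ∘ cong proj₁)) $
      ≈-trans (sumBits-single ℓ y λ y′ ≢y → sumBits-0 w λ z′ → f≈0 _ (≢y ∘ cong (proj₁ ∘ proj₂))) $
      sumBits-single w z λ z′ ≢z → f≈0 _ (≢z ∘ cong (proj₂ ∘ proj₂))

    sum-ket : ∀ (c : Basis n ℓ w) (h : Basis n ℓ w → 𝕂) →
      sum _+_ (λ b → h b * indicator (does (c ≟ b))) ≈ h c
    sum-ket c h = ≈-trans (sum-single c λ b b≢c → off b (b≢c ∘ sym)) on
      where
      off : ∀ b → c ≢ b → h b * indicator (does (c ≟ b)) ≈ 0#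
      off b c≢b rewrite dec-false (c ≟ b) c≢b = zeroʳ (h b)
      on : h c * indicator (does (c ≟ c)) ≈ h c
      on rewrite dec-true (c ≟ c) refl = *-identityʳ (h c)

    module Norm (conjugate : 𝕂 → 𝕂)
      (conj-cong : ∀ {a b} → a ≈ b → conjugate a ≈ conjugate b)
      (conj-+ : Additive conjugate)
      (conj-* : ∀ a b → conjugate (a * b) ≈ conjugate a * conjugate b)
      (conj-1 : conjugate 1# ≈ 1#) where

      open import Algebra.Properties.CommutativeSemigroup *-commutativeSemigroup
        using () renaming (interchange to *-interchange)

      normSq : (Basis n ℓ w → 𝕂) → 𝕂
      normSq ψ = sum _+_ λ b → conjugate (ψ b) * ψ b

      normSq-cong : ∀ {φ ψ} → (∀ b → φ b ≈ ψ b) → normSq φ ≈ normSq ψ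
      normSq-cong φ≈ψ = sum-cong λ b → *-cong (conj-cong (φ≈ψ b)) (φ≈ψ b)

      -- The states φ are given up to pointwise ≈ because over ℂ a conversion check between two
      -- presentations of the same state would unfold the Cauchy proofs.
      isometry-normSq : (M : Basis n ℓ w → Basis n ℓ w → 𝕂) →
        (∀ j k → sum _+_ (λ i → conjugate (M i j) * M i k) ≈ indicator (does (j ≟ k))) →
        ∀ φ ψ → (∀ i → φ i ≈ sum _+_ λ j → M i j * ψ j) → normSq φ ≈ normSq ψ
      isometry-normSq M iso φ ψ φ≈Mψ = begin
        normSq φ
          ≈⟨ normSq-cong φ≈Mψ ⟩
        Σ (λ i → conjugate (Σ λ j → M i j * ψ j) * Σ (λ k → M i k * ψ k))
          ≈⟨ sum-cong expand ⟩
        Σ (λ i → Σ λ j → Σ λ k → (conjugate (ψ j) * ψ k) * (conjugate (M i j) * M i k))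
          ≈⟨ sum-swap Σ sum-+ _ ⟩
        Σ (λ j → Σ λ i → Σ λ k → (conjugate (ψ j) * ψ k) * (conjugate (M i j) * M i k))
          ≈⟨ sum-cong (λ j → sum-swap Σ sum-+ _) ⟩
        Σ (λ j → Σ λ k → Σ λ i → (conjugate (ψ j) * ψ k) * (conjugate (M i j) * M i k))
          ≈⟨ sum-cong (λ j → sum-cong λ k → contract j k) ⟩
        Σ (λ j → Σ λ k → (conjugate (ψ j) * ψ k) * indicator (does (j ≟ k)))
          ≈⟨ sum-cong (λ j → sum-ket j _) ⟩
        Σ (λ j → conjugate (ψ j) * ψ j) ∎
        where
        Σ : (Basis n ℓ w → 𝕂) → 𝕂
        Σ = sum _+_
        expand : ∀ i → conjugate (Σ λ j → M i j * ψ j) * Σ (λ k → M i k * ψ k) ≈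
          Σ (λ j → Σ λ k → (conjugate (ψ j) * ψ k) * (conjugate (M i j) * M i k))
        expand i = begin
          conjugate (Σ λ j → M i j * ψ j) * Σ (λ k → M i k * ψ k)
            ≈⟨ *-congʳ (additive-sum conj-+ _) ⟩
          Σ (λ j → conjugate (M i j * ψ j)) * Σ (λ k → M i k * ψ k)
            ≈⟨ sum-*ʳ _ _ ⟩
          Σ (λ j → conjugate (M i j * ψ j) * Σ (λ k → M i k * ψ k))
            ≈⟨ sum-cong (λ j → sum-*ˡ _ _) ⟩
          Σ (λ j → Σ λ k → conjugate (M i j * ψ j) * (M i k * ψ k))
            ≈⟨ sum-cong (λ j → sum-cong λ k →
                 ≈-trans (*-congʳ (conj-* _ _)) (≈-trans (*-interchange _ _ _ _) (*-comm _ _))) ⟩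
          Σ (λ j → Σ λ k → (conjugate (ψ j) * ψ k) * (conjugate (M i j) * M i k)) ∎
        contract : ∀ j k → Σ (λ i → (conjugate (ψ j) * ψ k) * (conjugate (M i j) * M i k)) ≈
          (conjugate (ψ j) * ψ k) * indicator (does (j ≟ k))
        contract j k = ≈-trans (≈-sym (sum-*ˡ _ _)) (*-congˡ (iso j k))

      query-normSq : ∀ (f : Bits n → Bits ℓ) φ ψ →
        (∀ a y z → φ (a , y , z) ≈ ψ (a , y ⊕ f a , z)) → normSq φ ≈ normSq ψ
      query-normSq f φ ψ φ≈ = ≈-trans (normSq-cong λ (a , y , z) → φ≈ a y z) $
        sumBits-cong n λ a → sumBits-⊕ ℓ (f a) _

      ket-normSq : ∀ c φ → (∀ b → φ b ≈ indicator (does (c ≟ b))) → normSq φ ≈ 1#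
      ket-normSq c φ φ≈ket = ≈-trans (normSq-cong φ≈ket) (≈-trans (sum-ket c _) unit)
        where
        unit : conjugate (indicator (does (c ≟ c))) ≈ 1#
        unit rewrite dec-true (c ≟ c) refl = conj-1

  -- Degree< d F says that F is a multilinear polynomial of degree less than d in the bits x.
  data Degree< : (d : ℕ) → (Bits N → 𝕂) → Set where
    vanishing : {F : Bits N → 𝕂} → (∀ x → F x ≈ 0#) → Degree< zero F
    nullary   : {F : Bits 0 → 𝕂} → Degree< (suc d) F
    split     : {F : Bits (suc N) → 𝕂} (D : Bits N → 𝕂) →
                (∀ x → F (true ∷ x) ≈ F (false ∷ x) + D x) →
                Degree< (suc d) (F ∘ (false ∷_)) → Degree< d D → Degree< (suc d) F

  degree-resp : {F G : Bits N → 𝕂} → (∀ x → F x ≈ G x) → Degree< d F → Degree< d G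
  degree-resp F≈G (vanishing F≈0)        = vanishing λ x → ≈-trans (≈-sym (F≈G x)) (F≈0 x)
  degree-resp F≈G nullary                = nullary
  degree-resp F≈G (split D F≈ degF degD) = split D
    (λ x → ≈-trans (≈-sym (F≈G _)) (≈-trans (F≈ x) (+-congʳ (F≈G _))))
    (degree-resp (F≈G ∘ (false ∷_)) degF) degD

  degree-0 : ∀ N d → Degree< {N} d (λ _ → 0#)
  degree-0 N       zero    = vanishing λ _ → ≈-refl
  degree-0 zero    (suc d) = nullary
  degree-0 (suc N) (suc d) = split (λ _ → 0#) (λ _ → ≈-sym (+-identityˡ 0#)) (degree-0 N (suc d)) (degree-0 N d)

  degree-const : ∀ N d c → Degree< {N} (suc d) (λ _ → c)
  degree-const zero    d c = nullary
  degree-const (suc N) d c = split (λ _ → 0#) (λ _ → ≈-sym (+-identityʳ c)) (degree-const N d c) (degree-0 N d)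

  degree-suc : {F : Bits N → 𝕂} → Degree< d F → Degree< (suc d) F
  degree-suc (vanishing F≈0)        = degree-resp (≈-sym ∘ F≈0) (degree-0 _ _)
  degree-suc nullary                = nullary
  degree-suc (split D F≈ degF degD) = split D F≈ (degree-suc degF) (degree-suc degD)

  degree-+ : {F G : Bits N → 𝕂} → Degree< d F → Degree< d G → Degree< d (λ x → F x + G x)
  degree-+ (vanishing F≈0) (vanishing G≈0) =
    vanishing λ x → ≈-trans (+-cong (F≈0 x) (G≈0 x)) (+-identityˡ 0#)
  degree-+ nullary nullary = nullary
  degree-+ (split D F≈ degF degD) (split E G≈ degG degE) = split (λ x → D x + E x)
    (λ x → ≈-trans (+-cong (F≈ x) (G≈ x)) (interchange _ _ _ _))
    (degree-+ degF degG) (degree-+ degD degE)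

  -- Only sums occur in `Degree<`, so an additive map preserves it even if, like `conj`, it is not
  -- linear over the ring.
  degree-additive : ∀ {h} → (∀ {a b} → a ≈ b → h a ≈ h b) → Additive h →
    {F : Bits N → 𝕂} → Degree< d F → Degree< d (h ∘ F)
  degree-additive {h = h} h-cong h-+ (vanishing F≈0) = vanishing λ x → ≈-trans (h-cong (F≈0 x)) h-0
    where
    open import Algebra.Properties.Group +-group using (identityˡ-unique)
    h-0 : h 0# ≈ 0#
    h-0 = identityˡ-unique (h 0#) (h 0#) (≈-trans (≈-sym (h-+ 0# 0#)) (h-cong (+-identityˡ 0#)))
  degree-additive h-cong h-+ nullary = nullary
  degree-additive h-cong h-+ (split D F≈ degF degD) = split _
    (λ x → ≈-trans (h-cong (F≈ x)) (h-+ _ _))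
    (degree-additive h-cong h-+ degF) (degree-additive h-cong h-+ degD)

  degree-sum : (f : Bits N → Basis n ℓ w → 𝕂) → (∀ b → Degree< d (λ x → f x b)) →
    Degree< d (λ x → sum _+_ (f x))
  degree-sum = sum-closed _+_ (Degree< _) degree-+

  -- A discrete Leibniz rule: in the first bit the product has the difference `D G₁ + E F₀`. As
  -- `Degree< (suc d)` means degree at most `d`, the degrees add.
  degree-* : {F G : Bits N → 𝕂} → Degree< (suc d) F → Degree< (suc e) G →
    Degree< (suc (d ℕ.+ e)) (λ x → F x * G x)
  -- The differences `D` and `E` may have index `zero`, which `degree-*` does not admit; this form
  -- covers them.
  degree-*-weak : {F G : Bits N → 𝕂} → Degree< d F → Degree< (suc e) G →
    Degree< (d ℕ.+ e) (λ x → F x * G x)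

  degree-* nullary nullary = nullary
  degree-* {d = d} {e} {F} {G} (split D F≈ degF degD) (split E G≈ degG degE) =
    split (λ x → D x * G (true ∷ x) + E x * F (false ∷ x)) leibniz
      (degree-* degF degG)
      (degree-+
        (degree-*-weak degD (degree-resp (≈-sym ∘ G≈) (degree-+ degG (degree-suc degE))))
        (subst (λ k → Degree< k (λ x → E x * F (false ∷ x))) (ℕ.+-comm e d) (degree-*-weak degE degF)))
    where
    leibniz : ∀ x → F (true ∷ x) * G (true ∷ x) ≈
      F (false ∷ x) * G (false ∷ x) + (D x * G (true ∷ x) + E x * F (false ∷ x))
    leibniz x = begin
      F₁ * G₁                          ≈⟨ *-congʳ (F≈ x) ⟩
      (F₀ + D x) * G₁                  ≈⟨ distribʳ _ _ _ ⟩
      F₀ * G₁ + D x * G₁               ≈⟨ +-congʳ (≈-trans (*-congˡ (G≈ x)) (distribˡ _ _ _)) ⟩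
      F₀ * G₀ + F₀ * E x + D x * G₁    ≈⟨ +-assoc _ _ _ ⟩
      F₀ * G₀ + (F₀ * E x + D x * G₁)  ≈⟨ +-congˡ (≈-trans (+-comm _ _) (+-congˡ (*-comm _ _))) ⟩
      F₀ * G₀ + (D x * G₁ + E x * F₀)  ∎
      where
      F₀ = F (false ∷ x)
      F₁ = F (true ∷ x)
      G₀ = G (false ∷ x)
      G₁ = G (true ∷ x)

  degree-*-weak {d = zero}  (vanishing F≈0) degG =
    degree-resp (λ x → ≈-sym (≈-trans (*-congʳ (F≈0 x)) (zeroˡ _))) (degree-0 _ _)
  degree-*-weak {d = suc d} degF degG = degree-* degF degG

  -- For fixed `v` the value is one of the bits of `x` or constantly false, and every function of a
  -- single bit is affine in it.
  degree-value : (L : List (Bits n)) (v : Bits n) (h : Bool → 𝕂) → Degree< 2 (λ x → h (value L x v))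
  degree-value []      v h = nullary
  degree-value (k ∷ L) v h =
    split (D (does (v ≟ᵇ k))) (step (does (v ≟ᵇ k))) (rest (does (v ≟ᵇ k))) (degD (does (v ≟ᵇ k)))
    where
    D : Bool → Bits (length L) → 𝕂
    D c x = if c then - h false + h true else 0#
    step : ∀ c x → h (if c then true else value L x v) ≈ h (if c then false else value L x v) + D c x
    step true  x = ≈-sym (≈-trans (≈-sym (+-assoc _ _ _)) (≈-trans (+-congʳ (-‿inverseʳ _)) (+-identityˡ _)))
    step false x = ≈-sym (+-identityʳ _)
    rest : ∀ c → Degree< 2 (λ x → h (if c then false else value L x v))
    rest true  = degree-const _ _ _
    rest false = degree-value L v h
    degD : ∀ c → Degree< 1 (D c)
    degD true  = degree-const _ _ _
    degD false = degree-0 _ _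

  -- Here a query costs one degree: choosing by the bit `V x` is a sum of two products with the
  -- indicators of `V x` and its negation, each of degree at most 1.
  degree-choose : (V : Bits N → Bool) → (∀ h → Degree< 2 (h ∘ V)) →
    (F : Bool → Bits N → 𝕂) → (∀ b → Degree< (suc d) (F b)) → Degree< (suc (suc d)) (λ x → F (V x) x)
  degree-choose V degV F degF =
    degree-resp (λ x → pick (V x) x)
      (degree-+ (degree-* (degV indicator) (degF true)) (degree-* (degV (indicator ∘ not)) (degF false)))
    where
    pick : ∀ b x → indicator b * F true x + indicator (not b) * F false x ≈ F b x
    pick true  x = ≈-trans (+-cong (*-identityˡ _) (zeroˡ _)) (+-identityʳ _)
    pick false x = ≈-trans (+-cong (zeroˡ _) (*-identityˡ _)) (+-identityˡ _)

  -- The sum of the values F x, with sign -1 for every bit of x that is false.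
  altSum : ∀ N → (Bits N → 𝕂) → 𝕂
  altSum zero    F = F []
  altSum (suc N) F = altSum N λ x → F (true ∷ x) - F (false ∷ x)

  altSum-cong : ∀ N {F G} → (∀ x → F x ≈ G x) → altSum N F ≈ altSum N G
  altSum-cong zero    F≈G = F≈G []
  altSum-cong (suc N) F≈G = altSum-cong N λ x → +-cong (F≈G _) (-‿cong (F≈G _))

  altSum-0 : ∀ N {F} → (∀ x → F x ≈ 0#) → altSum N F ≈ 0#
  altSum-0 zero    F≈0 = F≈0 []
  altSum-0 (suc N) F≈0 = altSum-0 N λ x →
    ≈-trans (+-cong (F≈0 _) (-‿cong (F≈0 _))) (-‿inverseʳ 0#)

  -- Each bit replaces the function by its difference, which has one degree less; with `d ≤ N` the
  -- index reaches zero before the bits run out.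
  altSum-degree : {F : Bits N → 𝕂} → Degree< d F → d ℕ.≤ N → altSum N F ≈ 0#
  altSum-degree (vanishing F≈0) _ = altSum-0 _ F≈0
  altSum-degree {N = suc N} {F = F} (split D F≈ _ degD) (ℕ.s≤s d≤N) =
    ≈-trans (altSum-cong N difference) (altSum-degree degD d≤N)
    where
    difference : ∀ x → F (true ∷ x) - F (false ∷ x) ≈ D x
    difference x = begin
      F (true ∷ x) - F (false ∷ x)                ≈⟨ +-congʳ (≈-trans (F≈ x) (+-comm _ _)) ⟩
      D x + F (false ∷ x) - F (false ∷ x)         ≈⟨ +-assoc _ _ _ ⟩
      D x + (F (false ∷ x) - F (false ∷ x))       ≈⟨ +-congˡ (-‿inverseʳ _) ⟩
      D x + 0#                                    ≈⟨ +-identityʳ _ ⟩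
      D x                                         ∎

-- Homomorphisms hiding an ideal

vec-ext : ∀ {a} {A : Set a} {u v : Vec A n} → lookup u ≗ lookup v → u ≡ v
vec-ext {u = u} {v} u≗v =
  trans (sym (Vec.tabulate∘lookup u)) (trans (Vec.tabulate-cong u≗v) (Vec.tabulate∘lookup v))

-- For a basic operation this is the operation of `B ^ᴬ n` by definition; induction over a clone
-- needs it for arbitrary operations.
power : Operation k → Vec (Bits n) k → Bits n
power f vs = tabulate λ i → f (map (λ v → lookup v i) vs)

lookup-power : (f : Operation k) (vs : Vec (Bits n) k) (i : Fin n) →
  lookup (power f vs) i ≡ f (map (λ v → lookup v i) vs)
lookup-power f vs = Vec.lookup∘tabulate _

power-proj : (j : Fin k) (vs : Vec (Bits n) k) → power (λ v → lookup v j) vs ≡ lookup vs j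
power-proj j vs = vec-ext λ i → trans (lookup-power (λ v → lookup v j) vs i) (Vec.lookup-map j (λ v → lookup v i) vs)

power-comp : ∀ {l} (f : Operation l) (g : Fin l → Operation k) (vs : Vec (Bits n) k) →
  power (λ v → f (tabulate λ i → g i v)) vs ≡ power f (tabulate λ i → power (g i) vs)
power-comp f g vs = Vec.tabulate-cong λ i → cong f $ vec-ext λ j → begin
  lookup (tabulate λ j → g j (map (λ v → lookup v i) vs)) j         ≡⟨ Vec.lookup∘tabulate _ j ⟩
  g j (map (λ v → lookup v i) vs)                                   ≡⟨ lookup-power (g j) vs i ⟨
  lookup (power (g j) vs) i
    ≡⟨ cong (λ v → lookup v i) (Vec.lookup∘tabulate _ j) ⟨
  lookup (lookup (tabulate λ j → power (g j) vs) j) i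
    ≡⟨ Vec.lookup-map j _ (tabulate λ j → power (g j) vs) ⟨
  lookup (map (λ v → lookup v i) (tabulate λ j → power (g j) vs)) j ∎
  where open ≡-Reasoning

tail-power : (f : Operation k) (vs : Vec (Bits (suc m)) k) → tail (power f vs) ≡ power f (map tail vs)
tail-power f vs = Vec.tabulate-cong λ i → cong f $
  trans (Vec.map-cong (λ { (_ ∷ _) → refl }) vs) (Vec.map-∘ (λ v → lookup v i) tail vs)

-- Sends each vector to a canonical representative of its class, `false ∷ v` standing for a
-- collapsed pair. No quotient has to be formed, and the images stay vectors of `suc m` bits.
collapse : (Bits m → Bool) → Bits (suc m) → Bits (suc m)
collapse I (b ∷ v) = (if I v then false else b) ∷ v

module _ (I : Bits m → Bool) where

  Compatible : Operation k → Set
  Compatible {k} f = ∀ us vs → (∀ i → collapse I (lookup us i) ≡ collapse I (lookup vs i)) →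
    collapse I (power f us) ≡ collapse I (power f vs)

  -- For an operation without arguments this is vacuous, so the constants among the generators
  -- impose no condition on `I`.
  Absorbing : Operation k → Set
  Absorbing {k} f = ∀ (vs : Vec (Bits m) k) i → I (lookup vs i) ≡ true → I (power f vs) ≡ true

  collapse-∈ : ∀ {u v} → I (tail u) ≡ true → tail u ≡ tail v → collapse I u ≡ collapse I v
  collapse-∈ {_ ∷ u} {_ ∷ _} u∈I refl rewrite u∈I = refl

  collapse-∉ : ∀ v → I (tail v) ≡ false → collapse I v ≡ v
  collapse-∉ (_ ∷ v) v∉I rewrite v∉I = refl

  collapse-tail : ∀ {u v} → collapse I u ≡ collapse I v → tail u ≡ tail v
  collapse-tail {_ ∷ _} {_ ∷ _} = cong tail

  collapse-idem : ∀ v → collapse I (collapse I v) ≡ collapse I v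
  collapse-idem (b ∷ v) with I v
  ... | true  = refl
  ... | false = refl

  -- If the tail of the result is in `I`, its first bit is erased and the tails agree anyway. If
  -- not, absorption keeps the tail of every argument outside `I`, where `collapse I` is the
  -- identity, so the arguments themselves are equal.
  absorbing⇒compatible : (f : Operation k) → Absorbing f → Compatible f
  absorbing⇒compatible f absorbing us vs us~vs with I (power f (map tail us)) in eq
  ... | true  = collapse-∈ (trans (cong I (tail-power f us)) eq)
    (trans (tail-power f us) (trans (cong (power f) tails) (sym (tail-power f vs))))
    where
    tails : map tail us ≡ map tail vs
    tails = vec-ext λ i → trans (Vec.lookup-map i tail us)
      (trans (collapse-tail (us~vs i)) (sym (Vec.lookup-map i tail vs)))
  ... | false = cong (collapse I ∘ power f) (vec-ext us≗vs)
    where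
    outside : ∀ i → I (tail (lookup us i)) ≡ false
    outside i with I (tail (lookup us i)) in us∈I
    ... | false = refl
    ... | true  = contradiction
      (trans (sym eq) (absorbing (map tail us) i (trans (cong I (Vec.lookup-map i tail us)) us∈I))) λ ()
    us≗vs : lookup us ≗ lookup vs
    us≗vs i = trans (sym (collapse-∉ _ (outside i)))
      (trans (us~vs i) (collapse-∉ _ (trans (cong I (sym (collapse-tail (us~vs i)))) (outside i))))

  -- Absorption does not pass to the clone, since a projection ignores its other arguments.
  -- Compatibility does, so generators are converted before the induction.
  compatible-clone : (F : OperationSet p) → (∀ {k} {f : Operation k} → F f → Compatible f) →
    ∀ {k} {f : Operation k} → ⟨ F ⟩ f → Compatible f
  compatible-clone F c (gen f∈F)     us vs us~vs = c f∈F us vs us~vs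
  compatible-clone F c (proj j)      us vs us~vs =
    trans (cong (collapse I) (power-proj j us))
      (trans (us~vs j) (cong (collapse I) (sym (power-proj j vs))))
  compatible-clone F c (comp {f = f} {g} f∈ g∈) us vs us~vs =
    trans (cong (collapse I) (power-comp f g us))
      (trans (compatible-clone F c f∈ _ _ λ i →
                trans (cong (collapse I) (Vec.lookup∘tabulate _ i))
                  (trans (compatible-clone F c (g∈ i) us vs us~vs)
                    (cong (collapse I) (sym (Vec.lookup∘tabulate _ i)))))
        (cong (collapse I) (sym (power-comp f g vs))))
  compatible-clone F c (resp f≗g f∈) us vs us~vs =
    trans (cong (collapse I) (sym (Vec.tabulate-cong λ i → f≗g (map (λ v → lookup v i) us))))
      (trans (compatible-clone F c f∈ us vs us~vs)
        (cong (collapse I) (Vec.tabulate-cong λ i → f≗g (map (λ v → lookup v i) vs))))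

  collapse-algebra : {S : Signature o} → Algebra S Bool → Algebra S (Bits (suc m))
  collapse-algebra B s vs = collapse I ((B ^ᴬ suc m) s vs)

  collapse-homomorphism : {S : Signature o} (B : Algebra S Bool) → (∀ s → Compatible (B s)) →
    IsHomomorphism (B ^ᴬ suc m) (collapse-algebra B) (collapse I)
  collapse-homomorphism B c s vs = c s vs (map (collapse I) vs) λ i →
    sym (trans (cong (collapse I) (Vec.lookup-map i (collapse I) vs)) (collapse-idem (lookup vs i)))

-- Each bit of x decides, for its own k ∈ keys, whether k belongs to ideal x.
record IdealFamily {S : Signature o} (B : Algebra S Bool) (m : ℕ) : Set o where
  field
    keys    : List (Bits m)
    unique  : Unique keys
    forced  : Bits m → Bool
    key     : Bits m → Bits m
    forced-key : ∀ {k} → k ∈ keys → forced k ≡ false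
    key-key    : ∀ {k} → k ∈ keys → key k ≡ k
    many    : 2 ℕ.^ m ℕ.≤ suc m ℕ.* length keys

  ideal : Bits (length keys) → Bits m → Bool
  ideal x v = forced v ∨ value keys x (key v)

  field
    compatible : ∀ x s → Compatible (ideal x) (B s)

value-∈ : ∀ (L : List (Bits n)) x {v} → value L x v ≡ true → v ∈ L
value-∈ []      []      ()
value-∈ (k ∷ L) (b ∷ x) {v} v↦true with v ≟ᵇ k
... | yes v≡k = here v≡k
... | no  _   = there (value-∈ L x v↦true)

decode : (L : List (Bits m)) → (Bits (suc m) → Bits (suc m) → Bool) → Bits (length L)
decode []      R = []
decode (k ∷ L) R = R (true ∷ k) (false ∷ k) ∷ decode L R

decode-value : {L : List (Bits m)} → Unique L → ∀ R x →
  (∀ {k} → k ∈ L → R (true ∷ k) (false ∷ k) ≡ value L x k) → decode L R ≡ x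
decode-value [] R [] _ = refl
decode-value {L = k ∷ L} (k∉L ∷ uL) R (b ∷ x) R≡value = cong₂ _∷_
  (trans (R≡value (here refl)) (cong (λ c → if c then b else value L x k) (dec-true (k ≟ᵇ k) refl)))
  (decode-value uL R x λ {k′} k′∈L → trans (R≡value (there k′∈L))
    (cong (λ c → if c then b else value L x k′) (dec-false (k′ ≟ᵇ k) (All.lookup k∉L k′∈L ∘ sym))))

kernel-ideal : (I : Bits m → Bool) → ∀ R → IsKernelOf (collapse I) R →
  ∀ v → R (true ∷ v) (false ∷ v) ≡ I v
kernel-ideal I R ker v with I v in eq | R (true ∷ v) (false ∷ v) in eq′
... | true  | true  = refl
... | false | false = refl
... | true  | false = contradiction
  (trans (sym eq′) (Equivalence.from (ker _ _) (collapse-∈ I eq refl))) λ ()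
... | false | true  = contradiction
  (trans (sym (collapse-∉ I _ eq)) (trans (Equivalence.to (ker _ _) eq′) (collapse-∉ I _ eq))) λ ()

module _ {S : Signature o} {B : Algebra S Bool} (𝓘 : IdealFamily B m) where
  open IdealFamily 𝓘

  kernel-decode : ∀ x R → IsKernelOf (collapse (ideal x)) R → decode keys R ≡ x
  kernel-decode x R ker = decode-value unique R x λ {k} k∈ → begin
    R (true ∷ k) (false ∷ k)            ≡⟨ kernel-ideal (ideal x) R ker k ⟩
    forced k ∨ value keys x (key k)     ≡⟨ cong₂ _∨_ (forced-key k∈) (cong (value keys x) (key-key k∈)) ⟩
    value keys x k                      ∎
    where open ≡-Reasoning

-- Enumeration of the cube and its largest layer

allBits : ∀ n → List (Bits n)
allBits zero    = [] ∷ []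
allBits (suc n) = List.map (false ∷_) (allBits n) List.++ List.map (true ∷_) (allBits n)

length-allBits : ∀ n → length (allBits n) ≡ 2 ℕ.^ n
length-allBits zero    = refl
length-allBits (suc n) = begin
  length (allBits (suc n))
    ≡⟨ List.length-++ (List.map (false ∷_) (allBits n)) ⟩
  length (List.map (false ∷_) (allBits n)) ℕ.+ length (List.map (true ∷_) (allBits n))
    ≡⟨ cong₂ ℕ._+_ (half false) (half true) ⟩
  2 ℕ.^ n ℕ.+ 2 ℕ.^ n
    ≡⟨ cong (2 ℕ.^ n ℕ.+_) (ℕ.+-identityʳ (2 ℕ.^ n)) ⟨
  2 ℕ.^ suc n ∎
  where
  open ≡-Reasoning
  half : ∀ b → length (List.map (b Vec.∷_) (allBits n)) ≡ 2 ℕ.^ n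
  half b = trans (List.length-map (b Vec.∷_) (allBits n)) (length-allBits n)

allBits-unique : ∀ n → Unique (allBits n)
allBits-unique zero    = [] ∷ []
allBits-unique (suc n) = Unique.++⁺
  (Unique.map⁺ Vec.∷-injectiveʳ (allBits-unique n)) (Unique.map⁺ Vec.∷-injectiveʳ (allBits-unique n))
  λ (p , q) → case ∈-map⁻ (false ∷_) p , ∈-map⁻ (true ∷_) q of λ { ((_ , _ , refl) , (_ , _ , ())) }

module _ {A : Set} (ρ : A → ℕ) where

  length-<-≡ : ∀ t xs → All (λ x → ρ x ℕ.< suc t) xs →
    length xs ℕ.≤ length (filter (λ x → ρ x ℕ.<? t) xs) ℕ.+ length (filter (λ x → ρ x ℕ.≟ t) xs)
  length-<-≡ t []       []         = ℕ.z≤n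
  length-<-≡ t (x ∷ xs) (ρ<1+t ∷ ps) with length-<-≡ t xs ps | ρ x ℕ.<? t | ρ x ℕ.≟ t
  ... | ih | yes ρ<t | yes ρ≡t = contradiction ρ≡t (ℕ.<⇒≢ ρ<t)
  ... | ih | yes ρ<t | no  ρ≢t
    rewrite List.filter-accept (λ x → ρ x ℕ.<? t) {x} {xs} ρ<t
          | List.filter-reject (λ x → ρ x ℕ.≟ t) {x} {xs} ρ≢t = ℕ.s≤s ih
  ... | ih | no  ρ≮t | yes ρ≡t
    rewrite List.filter-reject (λ x → ρ x ℕ.<? t) {x} {xs} ρ≮t
          | List.filter-accept (λ x → ρ x ℕ.≟ t) {x} {xs} ρ≡t =
    ℕ.≤-trans (ℕ.s≤s ih) (ℕ.≤-reflexive (sym (ℕ.+-suc _ _)))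
  ... | ih | no  ρ≮t | no  ρ≢t = contradiction (ℕ.≤∧≢⇒< (ℕ.≤-pred ρ<1+t) ρ≢t) ρ≮t

  -- Pigeonhole, comparing the fibre over the top value `t` with the best one below. For the layers
  -- of the cube it gives the bound `2^m / (m + 1)` without any estimate of binomial coefficients.
  largest-fibre : ∀ t xs → All (λ x → ρ x ℕ.< t) xs →
    ∃[ k ] length xs ℕ.≤ t ℕ.* length (filter (λ x → ρ x ℕ.≟ k) xs)
  largest-fibre zero    []       []       = 0 , ℕ.z≤n
  largest-fibre zero    (x ∷ xs) (() ∷ _)
  largest-fibre (suc t) xs       ρ<1+t
    with largest-fibre t (filter (λ x → ρ x ℕ.<? t) xs) (All.all-filter (λ x → ρ x ℕ.<? t) xs)
  ... | k , below≤ = [ (λ le → k , bound le (ℕ.≤-refl)) , (λ le → t , bound ℕ.≤-refl le) ]′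
                       (ℕ.≤-total (fibre t) (fibre k))
    where
    open ℕ.≤-Reasoning
    fibre : ℕ → ℕ
    fibre j = length (filter (λ x → ρ x ℕ.≟ j) xs)
    bound : ∀ {j} → fibre t ℕ.≤ fibre j → fibre k ℕ.≤ fibre j → length xs ℕ.≤ suc t ℕ.* fibre j
    bound {j} t≤j k≤j = begin
      length xs                                                    ≤⟨ length-<-≡ t xs ρ<1+t ⟩
      length (filter (λ x → ρ x ℕ.<? t) xs) ℕ.+ fibre t              ≤⟨ ℕ.+-mono-≤ below≤ t≤j ⟩
      t ℕ.* length (filter (λ x → ρ x ℕ.≟ k) (filter (λ x → ρ x ℕ.<? t) xs)) ℕ.+ fibre j
        ≤⟨ ℕ.+-monoˡ-≤ (fibre j) (ℕ.*-monoʳ-≤ t (ℕ.≤-trans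
             (length-mono-≤ (filter⁺ (λ x → ρ x ℕ.≟ k) (λ x → ρ x ℕ.≟ k) (λ { refl p → p })
               (filter-⊆ (λ x → ρ x ℕ.<? t) xs)))
             k≤j)) ⟩
      t ℕ.* fibre j ℕ.+ fibre j                                        ≡⟨ ℕ.+-comm (t ℕ.* fibre j) (fibre j) ⟩
      suc t ℕ.* fibre j                                              ∎

occurrences : Bool → Bits n → ℕ
occurrences b = count (Bool._≟ b)

-- The strictness matters: a vector obtained from one in the layer is either that vector or falls
-- below the layer, where every ideal contains it. Hence the part of an ideal inside the layer is
-- unconstrained.
dominated : ∀ b (u v : Bits n) → (∀ i → lookup u i ≡ b → lookup v i ≡ b) →
  u ≡ v ⊎ occurrences b u ℕ.< occurrences b v
dominated b []      []      _ = inj₁ refl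
dominated b (c ∷ u) (d ∷ v) u⊆v with dominated b u v (u⊆v ∘ suc) | c Bool.≟ b | d Bool.≟ b
... | inj₁ refl | yes refl | _        = inj₁ (cong (_∷ u) (sym (u⊆v zero refl)))
... | inj₁ refl | no  c≢b  | yes refl = inj₂ (ℕ.n<1+n _)
... | inj₁ refl | no  c≢b  | no d≢b   =
  inj₁ (cong (_∷ u) (trans (Bool.¬-not c≢b) (sym (Bool.¬-not d≢b))))
... | inj₂ u<v  | yes refl | yes _    = inj₂ (ℕ.s<s u<v)
... | inj₂ u<v  | yes refl | no d≢b   = contradiction (u⊆v zero refl) d≢b
... | inj₂ u<v  | no  _    | yes _    = inj₂ (ℕ.m<n⇒m<1+n u<v)
... | inj₂ u<v  | no  _    | no _     = inj₂ u<v

-- Families of ideals for the three clones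

module _ {S : Signature o} (B : Algebra S Bool) where

  clone-compatible : (F : OperationSet p) (I : Bits m → Bool) → B ≼ ⟨ F ⟩ →
    (∀ {k} {f : Operation k} → F f → Absorbing I f) → ∀ s → Compatible I (B s)
  clone-compatible F I B≼F absorbing s =
    compatible-clone I F (λ {_} {f} f∈F → absorbing⇒compatible I f (absorbing f∈F)) (B≼F (gen (basic s)))

  -- The ideals consist of all vectors with fewer than k entries b together with
  -- an arbitrary set of vectors with exactly k, for the k giving the largest choice.
  layer-family : (F : OperationSet p) (b : Bool) → B ≼ ⟨ F ⟩ →
    (∀ {k} {f : Operation k} → F f → ∀ {n} (vs : Vec (Bits n) k) i j →
      lookup (power f vs) j ≡ b → lookup (lookup vs i) j ≡ b) →
    ∀ m → IdealFamily B m
  layer-family F b B≼F shrinks m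
    -- A vector of `m` bits has between 0 and `m` entries `b`, hence `suc m` layers.
    with largest-fibre (occurrences b) (suc m) (allBits m) (All.universal (ℕ.s≤s ∘ Vec.count≤n (Bool._≟ b)) (allBits m))
  ... | k , many = record
    { keys       = layer
    ; unique     = Unique.filter⁺ _ (allBits-unique m)
    ; forced     = low
    ; key        = λ v → v
    ; forced-key = λ v∈ → dec-false (_ ℕ.<? k) (ℕ.<-irrefl (on-layer v∈))
    ; key-key    = λ _ → refl
    ; many       = subst (ℕ._≤ suc m ℕ.* length layer) (length-allBits m) many
    ; compatible = λ x → clone-compatible F _ B≼F λ f∈F vs i → down-closed x
        (dominated b _ _ λ j → shrinks f∈F vs i j)
    }
    where
    layer : List (Bits m)
    layer = filter (λ v → occurrences b v ℕ.≟ k) (allBits m)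
    low : Bits m → Bool
    low v = occurrences b v ℕ.<ᵇ k
    on-layer : ∀ {v} → v ∈ layer → occurrences b v ≡ k
    on-layer v∈ = proj₂ (∈-filter⁻ (λ v → occurrences b v ℕ.≟ k) {xs = allBits m} v∈)
    bounded : ∀ x v → low v ∨ value layer x v ≡ true → occurrences b v ℕ.≤ k
    bounded x v v∈I with low v in eq
    ... | true  = ℕ.<⇒≤ (ℕ.<ᵇ⇒< _ k (Equivalence.from Bool.T-≡ eq))
    ... | false = ℕ.≤-reflexive (on-layer (value-∈ layer x {v} v∈I))
    down-closed : ∀ x {u v} → u ≡ v ⊎ occurrences b u ℕ.< occurrences b v →
      low v ∨ value layer x v ≡ true → low u ∨ value layer x u ≡ true
    down-closed x (inj₁ refl)     v∈I = v∈I
    down-closed x {u} {v} (inj₂ u<v)  v∈I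
      rewrite dec-true (occurrences b u ℕ.<? k) (ℕ.<-≤-trans u<v (bounded x v v∈I)) = refl

  ⋀-family : B ≼ ⋀ → ∀ m → IdealFamily B m
  ⋀-family B≼⋀ = layer-family ⋀-Generator true B≼⋀ shrinks
    where
    ∧-true : ∀ a {b} → a ∧ b ≡ true → a ≡ true × b ≡ true
    ∧-true true eq = refl , eq
    shrinks : ∀ {k} {f : Operation k} → ⋀-Generator f → ∀ {n} (vs : Vec (Bits n) k) i j →
      lookup (power f vs) j ≡ true → lookup (lookup vs i) j ≡ true
    shrinks meet (u ∷ v ∷ []) i j eq with ∧-true (lookup u j) (trans (sym (lookup-power and (u ∷ v ∷ []) j)) eq)
    shrinks meet (u ∷ v ∷ []) zero       j eq | p , q = p
    shrinks meet (u ∷ v ∷ []) (suc zero) j eq | p , q = q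

  -- Dually to meets, a join is false only where both arguments are, so layers count the entries
  -- `false`.
  ⋁-family : B ≼ ⋁ → ∀ m → IdealFamily B m
  ⋁-family B≼⋁ = layer-family ⋁-Generator false B≼⋁ shrinks
    where
    ∨-false : ∀ a {b} → a ∨ b ≡ false → a ≡ false × b ≡ false
    ∨-false false eq = refl , eq
    shrinks : ∀ {k} {f : Operation k} → ⋁-Generator f → ∀ {n} (vs : Vec (Bits n) k) i j →
      lookup (power f vs) j ≡ false → lookup (lookup vs i) j ≡ false
    shrinks join (u ∷ v ∷ []) i j eq with ∨-false (lookup u j) (trans (sym (lookup-power or (u ∷ v ∷ []) j)) eq)
    shrinks join (u ∷ v ∷ []) zero       j eq | p , q = p
    shrinks join (u ∷ v ∷ []) (suc zero) j eq | p , q = q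

  -- The ideals consist of arbitrarily chosen pairs {v , ¬ v}.
  𝖴-family : B ≼ 𝖴 → ∀ m → IdealFamily B m
  𝖴-family B≼𝖴 m = record
    { keys       = representatives m
    ; unique     = representatives-unique m
    ; forced     = λ _ → false
    ; key        = representative
    ; forced-key = λ _ → refl
    ; key-key    = representative-fixed m
    ; many       = representatives-many m
    ; compatible = λ x → clone-compatible 𝖴-Generator _ B≼𝖴 λ f∈ → absorbing x f∈
    }
    where
    representative : Bits n → Bits n
    representative []          = []
    representative (false ∷ v) = false ∷ v
    representative (true ∷ v)  = false ∷ map not v
    representatives : ∀ n → List (Bits n)
    -- The empty vector is its own negation, so in dimension 0 the only pair degenerates to one
    -- vector.
    representatives zero    = [] ∷ []
    representatives (suc n) = List.map (false ∷_) (allBits n)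
    representatives-unique : ∀ n → Unique (representatives n)
    representatives-unique zero    = [] ∷ []
    representatives-unique (suc n) = Unique.map⁺ Vec.∷-injectiveʳ (allBits-unique n)
    representative-fixed : ∀ n {v} → v ∈ representatives n → representative v ≡ v
    representative-fixed zero    (here refl) = refl
    representative-fixed (suc n) v∈ with ∈-map⁻ (false ∷_) v∈
    ... | _ , _ , refl = refl
    representatives-many : ∀ n → 2 ℕ.^ n ℕ.≤ suc n ℕ.* length (representatives n)
    representatives-many zero    = ℕ.≤-refl
    -- Half of the vectors are representatives, and `2 ≤ n + 2`.
    representatives-many (suc n)
      rewrite List.length-map (false Vec.∷_) (allBits n) | length-allBits n =
      ℕ.*-monoˡ-≤ (2 ℕ.^ n) (ℕ.s≤s (ℕ.s≤s (ℕ.z≤n {n})))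
    power-negation : (v : Bits n) → power negation (v ∷ []) ≡ map not v
    power-negation v = trans (Vec.tabulate-∘ not (lookup v)) (cong (map not) (Vec.tabulate∘lookup v))
    map-not-not : (v : Bits n) → map not (map not v) ≡ v
    map-not-not v = trans (sym (Vec.map-∘ not not v)) (trans (Vec.map-cong Bool.not-involutive v) (Vec.map-id v))
    representative-not : (v : Bits n) → representative (map not v) ≡ representative v
    representative-not []          = refl
    representative-not (false ∷ v) = cong (false ∷_) (map-not-not v)
    representative-not (true ∷ v)  = refl
    absorbing : ∀ x {k} {f : Operation k} → 𝖴-Generator f →
      Absorbing (value (representatives m) x ∘ representative) f
    absorbing x neg (v ∷ []) zero v∈I =
      trans (cong (value (representatives m) x)
        (trans (cong representative (power-negation v)) (representative-not v))) v∈I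

-- Amplitudes of a query algorithm

open CommutativeRing ℂ-commutativeRing using (_-_)
open RingSums ℂ-commutativeRing

conj-cong : ∀ {x y} → x ≈ᶜ y → conj x ≈ᶜ conj y
conj-cong {x} {y} (equal r i) = equal r (-ʳ-cong {im x} {im y} i)

conj-+ : ∀ x y → conj (x +ᶜ y) ≈ᶜ conj x +ᶜ conj y
conj-+ x y = ≗⇒≈ᶜ
  (λ _ → refl) (λ n → ℚ.neg-distrib-+ (seq (im x) n) (seq (im y) n))

conj-* : ∀ x y → conj (x *ᶜ y) ≈ᶜ conj x *ᶜ conj y
conj-* x y = ≗⇒≈ᶜ
  (λ n → solve 4 (λ a b c d → a :* c :+ :- (b :* d) := a :* c :+ :- (:- b :* :- d)) refl
    (seq (re x) n) (seq (im x) n) (seq (re y) n) (seq (im y) n))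
  (λ n → solve 4 (λ a b c d → :- (a :* d :+ b :* c) := a :* :- d :+ :- b :* c) refl
    (seq (re x) n) (seq (im x) n) (seq (re y) n) (seq (im y) n))
  where open +-*-Solver

conj-1ᶜ : conj 1ᶜ ≈ᶜ 1ᶜ
conj-1ᶜ = ≗⇒≈ᶜ (λ _ → refl) (λ _ → refl)

≈ᶜ-reflexive : ∀ {x y} → x ≡ y → x ≈ᶜ y
≈ᶜ-reflexive refl = ≈ᶜ-refl

opaque
  unfolding IsUnitary
  unitary-† : (U : Unitary n ℓ w) → ∀ j k → ((matrix U †) ⊙ matrix U) j k ≃ᶜ 𝟙 j k
  unitary-† U = proj₁ (unitary U)

unitary-isometry : (U : Unitary n ℓ w) →
  ∀ j k → sum _+ᶜ_ (λ i → conj (matrix U i j) *ᶜ matrix U i k) ≈ᶜ indicator (does (j ≟ k))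
unitary-isometry {n} {ℓ} {w} U j k = ≈ᶜ-trans
  (BasisSums.sum-cong n ℓ w
    {λ i → conj (matrix U i j) *ᶜ matrix U i k} {λ i → (matrix U †) j i *ᶜ matrix U i k}
    λ i → ≗⇒≈ᶜ (λ _ → refl) (λ _ → refl))
  (equal (proj₁ (unitary-† U j k)) (proj₂ (unitary-† U j k)))

run : (Bits n → Bits ℓ) → State n ℓ w → List (Unitary n ℓ w) → State n ℓ w
run f = foldl λ ψ V → matrix V · oracle f ψ

module _ {n ℓ w : ℕ} where
  open BasisSums.Norm n ℓ w conj conj-cong conj-+ conj-* conj-1ᶜ public

  unitary-normSq : (U : Unitary n ℓ w) (ψ : State n ℓ w) → normSq (matrix U · ψ) ≈ᶜ normSq ψ
  unitary-normSq U ψ = isometry-normSq (matrix U) (unitary-isometry U) (matrix U · ψ) ψ λ _ → ≈ᶜ-refl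

  oracle-normSq : (f : Bits n → Bits ℓ) (ψ : State n ℓ w) → normSq (oracle f ψ) ≈ᶜ normSq ψ
  oracle-normSq f ψ = query-normSq f (oracle f ψ) ψ λ _ _ _ → ≈ᶜ-refl

  run-normSq : (f : Bits n → Bits ℓ) (Us : List (Unitary n ℓ w)) (φ ψ : State n ℓ w) →
    (∀ b → φ b ≡ run f ψ Us b) → normSq φ ≈ᶜ normSq ψ
  run-normSq f []       φ ψ φ≡ = normSq-cong {φ} {ψ} λ b → ≈ᶜ-reflexive (φ≡ b)
  run-normSq f (U ∷ Us) φ ψ φ≡ = ≈ᶜ-trans
    (run-normSq f Us φ (matrix U · oracle f ψ) φ≡)
    (≈ᶜ-trans (unitary-normSq U (oracle f ψ)) (oracle-normSq f ψ))

  prepared-run-normSq : (U : Unitary n ℓ w) (c : Basis n ℓ w) (f : Bits n → Bits ℓ) (Us : List (Unitary n ℓ w))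
    (φ ψ : State n ℓ w) → (∀ b → φ b ≡ run f ψ Us b) →
    (∀ i → ψ i ≈ᶜ sum _+ᶜ_ λ j → matrix U i j *ᶜ ket c j) → normSq φ ≈ᶜ 1ᶜ
  prepared-run-normSq U c f Us φ ψ φ≡ ψ≈ = ≈ᶜ-trans (run-normSq f Us φ ψ φ≡)
    (≈ᶜ-trans (isometry-normSq (matrix U) (unitary-isometry U) ψ (ket c) ψ≈)
      (ket-normSq c (ket c) λ _ → ≈ᶜ-refl))

zeros : ∀ n ℓ w → Basis n ℓ w
zeros n ℓ w = replicate n false , replicate ℓ false , replicate w false

final-normSq : (𝒜 : QueryAlgorithm n ℓ) (f : Bits n → Bits ℓ) → normSq (final 𝒜 f) ≈ᶜ 1ᶜ
final-normSq {n} {ℓ} 𝒜 f =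
  prepared-run-normSq (initial 𝒜) (zeros n ℓ (workspace 𝒜)) f (steps 𝒜) (final 𝒜 f) _ (λ _ → refl) λ i →
    BasisSums.sum-cong n ℓ (workspace 𝒜) λ j → ≗⇒≈ᶜ (λ _ → refl) (λ _ → refl)

-- Matrix entries do not depend on the unknown bits, so the degree grows only through queries.
degree-matrix : (M : Matrix n ℓ w) (ψ : Bits N → State n ℓ w) →
  (∀ b → Degree< (suc d) (λ x → ψ x b)) → ∀ b → Degree< (suc d) (λ x → (M · ψ x) b)
degree-matrix M ψ degψ b = degree-sum (λ x j → M b j *ᶜ ψ x j) λ j →
  degree-* {F = λ _ → M b j} {λ x → ψ x j} (degree-const _ 0 (M b j)) (degψ j)

module _ (V : Bits n → Bits N → Bool) (degV : ∀ a h → Degree< 2 (h ∘ V a))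
  (answer : Bits n → Bool → Bits ℓ) (f : Bits N → Bits n → Bits ℓ) (f≡ : ∀ x a → f x a ≡ answer a (V a x)) where

  -- The argument `a` is part of the basis vector, so each amplitude after the query is an old
  -- amplitude chosen by the single bit `V a x`. A query in superposition therefore also raises the
  -- degree by just one.
  degree-oracle : (ψ : Bits N → State n ℓ w) → (∀ b → Degree< (suc d) (λ x → ψ x b)) →
    ∀ b → Degree< (suc (suc d)) (λ x → oracle (f x) (ψ x) b)
  degree-oracle ψ degψ (a , y , z) =
    degree-resp (λ x → ≈ᶜ-reflexive (cong (λ v → ψ x (a , y ⊕ v , z)) (sym (f≡ x a))))
      (degree-choose (V a) (degV a) (λ c x → ψ x (a , y ⊕ answer a c , z)) λ c → degψ _)

  degree-run : (Us : List (Unitary n ℓ w)) (φ ψ : Bits N → State n ℓ w) →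
    (∀ x b → φ x b ≡ run (f x) (ψ x) Us b) → (∀ b → Degree< (suc d) (λ x → ψ x b)) →
    ∀ b → Degree< (suc (length Us ℕ.+ d)) (λ x → φ x b)
  degree-run         []       φ ψ φ≡ degψ b = degree-resp (λ x → ≈ᶜ-reflexive (sym (φ≡ x b))) (degψ b)
  degree-run {d = d} (U ∷ Us) φ ψ φ≡ degψ b =
    subst (λ k → Degree< (suc k) (λ x → φ x b)) (ℕ.+-suc (length Us) d)
      (degree-run Us φ (λ x → matrix U · oracle (f x) (ψ x)) φ≡
        (degree-matrix (matrix U) (λ x → oracle (f x) (ψ x)) (degree-oracle ψ degψ)) b)

  degree-final : (𝒜 : QueryAlgorithm n ℓ) → ∀ b → Degree< (suc (queries 𝒜)) (λ x → final 𝒜 (f x) b)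
  degree-final 𝒜 b =
    subst (λ k → Degree< (suc k) (λ x → final 𝒜 (f x) b)) (ℕ.+-identityʳ (queries 𝒜))
      (degree-run (steps 𝒜) (λ x → final 𝒜 (f x)) _ (λ _ _ → refl)
        (λ i → degree-resp
          (λ x → BasisSums.sum-cong n ℓ (workspace 𝒜)
            {λ j → matrix (initial 𝒜) i j *ᶜ ket (zeros n ℓ (workspace 𝒜)) j}
            λ j → ≗⇒≈ᶜ (λ _ → refl) (λ _ → refl))
          (degree-const _ 0 _)) b)

-- Computing a parity

quarter-pos : ∀ {δ} → 0ℚ ℚ.< δ → 0ℚ ℚ.< ½ ℚ.* (½ ℚ.* δ)
quarter-pos = half-pos ∘ half-pos

p≤∣p∣ : ∀ q → q ℚ.≤ ∣ q ∣
p≤∣p∣ q = [ (λ 0≤q → ℚ.≤-reflexive (sym (ℚ.0≤p⇒∣p∣≡p 0≤q))) , (λ q≤0 → ℚ.≤-trans q≤0 (ℚ.0≤∣p∣ q)) ]′ (ℚ.≤-total 0ℚ q)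

square-nonNeg : ∀ a → 0ℚ ℚ.≤ a ℚ.* a
square-nonNeg a = subst (0ℚ ℚ.≤_) (∣a∣² (ℚ.∣p∣≡p∨∣p∣≡-p a))
  (subst (ℚ._≤ ∣ a ∣ ℚ.* ∣ a ∣) (ℚ.*-zeroˡ ∣ a ∣)
    (ℚ.*-monoʳ-≤-nonNeg ∣ a ∣ {{ℚ.∣-∣-nonNeg a}} (ℚ.0≤∣p∣ a)))
  where
  open +-*-Solver
  ∣a∣² : ∀ {c} → c ≡ a ⊎ c ≡ ℚ.- a → c ℚ.* c ≡ a ℚ.* a
  ∣a∣² (inj₁ refl) = refl
  ∣a∣² (inj₂ refl) = solve 1 (λ x → :- x :* :- x := x :* x) refl a

≤ʳ-sum : ∀ {q x y z} → 0ℚ ℚ.≤ q → (∀ n → seq x n ℚ.+ seq y n ≡ seq z n) →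
  fromℚ q ≤ʳ x → fromℚ q ≤ʳ y → fromℚ q ≤ʳ z
≤ʳ-sum {q} {x} {y} {z} 0≤q x+y≡z q≤x q≤y δ 0<δ =
  eventually-map bound (eventually-∧ (q≤x _ (half-pos 0<δ)) (q≤y _ (half-pos 0<δ)))
  where
  open ℚ.≤-Reasoning
  open +-*-Solver
  bound : ∀ n → q ℚ.≤ seq x n ℚ.+ ½ ℚ.* δ × q ℚ.≤ seq y n ℚ.+ ½ ℚ.* δ → q ℚ.≤ seq z n ℚ.+ δ
  bound n (≤x , ≤y) = begin
    q                                                        ≡⟨ ℚ.+-identityˡ q ⟨
    0ℚ ℚ.+ q                                                 ≤⟨ ℚ.+-monoˡ-≤ q 0≤q ⟩
    q ℚ.+ q                                                  ≤⟨ ℚ.+-mono-≤ ≤x ≤y ⟩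
    (seq x n ℚ.+ ½ ℚ.* δ) ℚ.+ (seq y n ℚ.+ ½ ℚ.* δ)
      ≡⟨ solve 3 (λ a b c → (a :+ c) :+ (b :+ c) := (a :+ b) :+ (c :+ c)) refl (seq x n) (seq y n) (½ ℚ.* δ) ⟩
    (seq x n ℚ.+ seq y n) ℚ.+ (½ ℚ.* δ ℚ.+ ½ ℚ.* δ)          ≡⟨ cong₂ ℚ._+_ (x+y≡z n) (halves δ) ⟩
    seq z n ℚ.+ δ                                            ∎

-- `true` is the sign +1. The false bits are the ones counted, in accordance with the signs of
-- `altSum`.
parity : Bits N → Bool
parity []          = true
parity (true ∷ x)  = parity x
parity (false ∷ x) = not (parity x)

signed : Bool → ℂ → ℂ
signed true  z = z
signed false z = -ᶜ z

signed-cong : ∀ s {y z} → y ≈ᶜ z → signed s y ≈ᶜ signed s z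
signed-cong true  y≈z = y≈z
signed-cong false y≈z = -ᶜ-cong y≈z

signed-+ : ∀ s y z → signed s (y +ᶜ z) ≈ᶜ signed s y +ᶜ signed s z
signed-+ true  y z = ≗⇒≈ᶜ (λ _ → refl) (λ _ → refl)
signed-+ false y z = ≗⇒≈ᶜ
  (λ n → ℚ.neg-distrib-+ (seq (re y) n) (seq (re z) n)) (λ n → ℚ.neg-distrib-+ (seq (im y) n) (seq (im z) n))

re-signed-+ : ∀ s y z n →
  seq (re (signed s (y +ᶜ z))) n ≡ seq (re (signed s y)) n ℚ.+ seq (re (signed s z)) n
re-signed-+ true  y z n = refl
re-signed-+ false y z n = ℚ.neg-distrib-+ (seq (re y) n) (seq (re z) n)

-- With the signs of the parity nothing cancels. The sum is even at least `2^N` times `q`, but a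
-- positive bound independent of `N` suffices against the value 0.
altSum-lower : ∀ {q} → 0ℚ ℚ.≤ q → ∀ N (F : Bits N → ℂ) →
  (∀ x → fromℚ q ≤ʳ re (signed (parity x) (F x))) → fromℚ q ≤ʳ re (altSum N F)
altSum-lower {q} 0≤q zero    F q≤ = q≤ []
altSum-lower {q} 0≤q (suc N) F q≤ = altSum-lower 0≤q N (λ x → F (true ∷ x) - F (false ∷ x)) λ x →
  ≤ʳ-sum {q} {re (signed (parity x) (F (true ∷ x)))} {re (signed (not (parity x)) (F (false ∷ x)))}
    {re (signed (parity x) (F (true ∷ x) - F (false ∷ x)))}
    0≤q (difference (parity x) (F (true ∷ x)) (F (false ∷ x))) (q≤ (true ∷ x)) (q≤ (false ∷ x))
  where
  open +-*-Solver
  difference : ∀ s y z n → seq (re (signed s y)) n ℚ.+ seq (re (signed (not s) z)) n ≡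
    seq (re (signed s (y - z))) n
  difference true  y z n = refl
  difference false y z n =
    solve 2 (λ a b → :- a :+ b := :- (a :+ :- b)) refl (seq (re y) n) (seq (re z) n)

-- Twice the probability of success minus the total probability bounds the
-- expectation of the ±1-valued product of guessed and true sign.
module _ (s : Bool) where
  Bounds : ℂ → ℝ → ℂ → Set
  Bounds a p t = ∀ n → seq p n ℚ.+ seq p n ℚ.≤ seq (re (signed s a)) n ℚ.+ seq (re t) n

  bounds-+ : ∀ {a a′ p p′ t t′} → Bounds a p t → Bounds a′ p′ t′ → Bounds (a +ᶜ a′) (p +ʳ p′) (t +ᶜ t′)
  bounds-+ {a} {a′} {p} {p′} {t} {t′} b b′ n = begin
    (seq p n ℚ.+ seq p′ n) ℚ.+ (seq p n ℚ.+ seq p′ n)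
      ≡⟨ interchange (seq p n) (seq p′ n) (seq p n) (seq p′ n) ⟩
    (seq p n ℚ.+ seq p n) ℚ.+ (seq p′ n ℚ.+ seq p′ n)
      ≤⟨ ℚ.+-mono-≤ (b n) (b′ n) ⟩
    (seq (re (signed s a)) n ℚ.+ seq (re t) n) ℚ.+ (seq (re (signed s a′)) n ℚ.+ seq (re t′) n)
      ≡⟨ interchange (seq (re (signed s a)) n) (seq (re t) n) (seq (re (signed s a′)) n) (seq (re t′) n) ⟩
    (seq (re (signed s a)) n ℚ.+ seq (re (signed s a′)) n) ℚ.+ (seq (re t) n ℚ.+ seq (re t′) n)
      ≡⟨ cong (ℚ._+ (seq (re t) n ℚ.+ seq (re t′) n)) (re-signed-+ s a a′ n) ⟨
    seq (re (signed s (a +ᶜ a′))) n ℚ.+ (seq (re t) n ℚ.+ seq (re t′) n) ∎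
    where
    open ℚ.≤-Reasoning
    open +-*-Solver
    interchange : ∀ a b c d → (a ℚ.+ b) ℚ.+ (c ℚ.+ d) ≡ (a ℚ.+ c) ℚ.+ (b ℚ.+ d)
    interchange = solve 4 (λ a b c d → (a :+ b) :+ (c :+ d) := (a :+ c) :+ (b :+ d)) refl

  -- On success the guess is right and both sides are `2|z|²`. Otherwise the left side is 0 and the
  -- right side is `|z|² ± |z|²`, depending on whether the guess happens to be right.
  bounds-term : ∀ {P : Set} (P? : Dec P) g → (P → g ≡ s) → ∀ z →
    Bounds (signed g (conj z *ᶜ z)) (if does P? then ∣ z ∣² else 0ʳ) (conj z *ᶜ z)
  bounds-term (yes p) g g≡s z n = ℚ.≤-reflexive (trans (agree s)
    (cong (λ g → seq (re (signed s (signed g (conj z *ᶜ z)))) n ℚ.+ seq (re (conj z *ᶜ z)) n) (sym (g≡s p))))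
    where
    open +-*-Solver
    a = seq (re z) n
    b = seq (im z) n
    agree : ∀ s → seq ∣ z ∣² n ℚ.+ seq ∣ z ∣² n ≡
      seq (re (signed s (signed s (conj z *ᶜ z)))) n ℚ.+ seq (re (conj z *ᶜ z)) n
    agree true  = solve 2 (λ a b → (a :* a :+ b :* b) :+ (a :* a :+ b :* b) :=
      (a :* a :+ :- (:- b :* b)) :+ (a :* a :+ :- (:- b :* b))) refl a b
    agree false = solve 2 (λ a b → (a :* a :+ b :* b) :+ (a :* a :+ b :* b) :=
      :- (:- (a :* a :+ :- (:- b :* b))) :+ (a :* a :+ :- (:- b :* b))) refl a b
  bounds-term (no _) g _ z n = disagree s g
    where
    open +-*-Solver
    a = seq (re z) n
    b = seq (im z) n
    c = seq (re (conj z *ᶜ z)) n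
    0≤c : 0ℚ ℚ.≤ c
    0≤c = subst (0ℚ ℚ.≤_) (solve 2 (λ a b → a :* a :+ b :* b := a :* a :+ :- (:- b :* b)) refl a b)
      (ℚ.+-mono-≤ (square-nonNeg a) (square-nonNeg b))
    cancel : 0ℚ ℚ.≤ ℚ.- c ℚ.+ c
    cancel = ℚ.≤-reflexive (sym (ℚ.+-inverseˡ c))
    disagree : ∀ s g → 0ℚ ℚ.+ 0ℚ ℚ.≤ seq (re (signed s (signed g (conj z *ᶜ z)))) n ℚ.+ c
    disagree true  true  = ℚ.+-mono-≤ 0≤c 0≤c
    disagree true  false = cancel
    disagree false true  = cancel
    disagree false false = subst (λ q → 0ℚ ℚ.≤ q ℚ.+ c) (solve 1 (λ x → x :=
        :- (:- x)) refl c) (ℚ.+-mono-≤ 0≤c 0≤c)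

module _ (𝒜 : QueryAlgorithm n ℓ) (guess : Basis n ℓ (workspace 𝒜) → Bool) where

  expectation : (Bits n → Bits ℓ) → ℂ
  expectation f = sum _+ᶜ_ λ b → signed (guess b) (conj (final 𝒜 f b) *ᶜ final 𝒜 f b)

  -- The expectation is at least twice the success probability minus the total probability, and
  -- `2 · 2/3 - 1 = 1/3`.
  expectation-lower : (f : Bits n → Bits ℓ) {P : (Bits n → Bits n → Bool) → Set} (P? : ∀ R → Dec (P R)) (s : Bool) →
    (∀ b → P (output 𝒜 b) → guess b ≡ s) → fromℚ (+ 2 / 3) ≤ʳ probability 𝒜 f P? →
    fromℚ (+ 1 / 3) ≤ʳ re (signed s (expectation f))
  expectation-lower f P? s right 2/3≤ δ 0<δ =
    -- The slack `δ` is spent as a quarter on the success probability, which is then doubled, and a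
    -- half on the norm, whose terms only tend to 1.
    eventually-map bound (eventually-∧ (2/3≤ _ (quarter-pos 0<δ)) (re-≃ (final-normSq 𝒜 f) _ (half-pos 0<δ)))
    where
    open ℚ.≤-Reasoning
    open +-*-Solver
    success total E : ℕ → ℚ
    success = seq (probability 𝒜 f P?)
    total = seq (re (normSq (final 𝒜 f)))
    E = seq (re (signed s (expectation f)))
    combine : ∀ n → success n ℚ.+ success n ℚ.≤ E n ℚ.+ total n
    combine = sum-related₃ _+ᶜ_ _+ʳ_ _+ᶜ_ (Bounds s)
      (λ {a} {a′} {p} {p′} {t} {t′} → bounds-+ s {a} {a′} {p} {p′} {t} {t′})
      {f = λ b → signed (guess b) (conj (final 𝒜 f b) *ᶜ final 𝒜 f b)}
      {λ b → if does (P? (output 𝒜 b)) then ∣ final 𝒜 f b ∣² else 0ʳ}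
      {λ b → conj (final 𝒜 f b) *ᶜ final 𝒜 f b}
      λ b → bounds-term s (P? (output 𝒜 b)) (guess b) (right b) (final 𝒜 f b)
    η = ½ ℚ.* (½ ℚ.* δ)
    bound : ∀ n → + 2 / 3 ℚ.≤ success n ℚ.+ η × ∣ total n ℚ.- 1ℚ ∣ ℚ.< ½ ℚ.* δ → + 1 / 3 ℚ.≤ E n ℚ.+ δ
    bound n (≤p , t<) = begin
      + 1 / 3                                             ≡⟨⟩
      (+ 2 / 3 ℚ.+ + 2 / 3) ℚ.- 1ℚ                        ≤⟨ ℚ.+-monoˡ-≤ (ℚ.- 1ℚ) (ℚ.+-mono-≤ ≤p ≤p) ⟩
      ((success n ℚ.+ η) ℚ.+ (success n ℚ.+ η)) ℚ.- 1ℚ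
        ≡⟨ solve 2 (λ a e → ((a :+ e) :+ (a :+ e)) :- con 1ℚ :=
            (a :+ a) :+ ((e :+ e) :- con 1ℚ)) refl (success n) η ⟩
      (success n ℚ.+ success n) ℚ.+ ((η ℚ.+ η) ℚ.- 1ℚ)
        ≤⟨ ℚ.+-monoˡ-≤ ((η ℚ.+ η) ℚ.- 1ℚ) (combine n) ⟩
      (E n ℚ.+ total n) ℚ.+ ((η ℚ.+ η) ℚ.- 1ℚ)
        ≡⟨ cong (λ h → (E n ℚ.+ total n) ℚ.+ (h ℚ.- 1ℚ)) (halves (½ ℚ.* δ)) ⟩
      (E n ℚ.+ total n) ℚ.+ (½ ℚ.* δ ℚ.- 1ℚ)
        ≡⟨ solve 3 (λ a b h → (a :+ b) :+ (h :- con 1ℚ) :=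
            a :+ ((b :- con 1ℚ) :+ h)) refl (E n) (total n) (½ ℚ.* δ) ⟩
      E n ℚ.+ ((total n ℚ.- 1ℚ) ℚ.+ ½ ℚ.* δ)
        ≤⟨ ℚ.+-monoʳ-≤ (E n) (ℚ.+-monoˡ-≤ (½ ℚ.* δ) (ℚ.≤-trans (p≤∣p∣ (total n ℚ.- 1ℚ)) (ℚ.<⇒≤ t<))) ⟩
      E n ℚ.+ (½ ℚ.* δ ℚ.+ ½ ℚ.* δ)                       ≡⟨ cong (E n ℚ.+_) (halves δ) ⟩
      E n ℚ.+ δ                                           ∎

1/3≰ʳnull : ∀ {z} → z ≈ᶜ 0ᶜ → ¬ (fromℚ (+ 1 / 3) ≤ʳ re z)
1/3≰ʳnull {z} (equal z≃0 _) 1/3≤ = contradiction (bound (proj₂ both (proj₁ both) ℕ.≤-refl)) (ℚ.<-irrefl refl)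
  where
  open ℚ.≤-Reasoning
  -- Two errors of 1/6, one of them strict, add up to less than 1/3.
  0<1/6 : 0ℚ ℚ.< + 1 / 6
  0<1/6 = ℚ.positive⁻¹ (+ 1 / 6)
  both = eventually-∧ (1/3≤ _ 0<1/6) (z≃0 _ 0<1/6)
  bound : ∀ {n} → + 1 / 3 ℚ.≤ seq (re z) n ℚ.+ + 1 / 6 × ∣ seq (re z) n ℚ.- 0ℚ ∣ ℚ.< + 1 / 6 → + 1 / 3 ℚ.< + 1 / 3
  bound {n} (1/3≤z , z<) = begin-strict
    + 1 / 3                              ≤⟨ 1/3≤z ⟩
    seq (re z) n ℚ.+ + 1 / 6             ≡⟨ cong (ℚ._+ + 1 / 6) (ℚ.+-identityʳ (seq (re z) n)) ⟨
    (seq (re z) n ℚ.- 0ℚ) ℚ.+ + 1 / 6    ≤⟨ ℚ.+-monoˡ-≤ (+ 1 / 6) (p≤∣p∣ (seq (re z) n ℚ.- 0ℚ)) ⟩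
    ∣ seq (re z) n ℚ.- 0ℚ ∣ ℚ.+ + 1 / 6  <⟨ ℚ.+-monoˡ-< (+ 1 / 6) z< ⟩
    + 1 / 6 ℚ.+ + 1 / 6                  ≡⟨⟩
    + 1 / 3                              ∎

degree-expectation : (𝒜 : QueryAlgorithm n ℓ) (guess : Basis n ℓ (workspace 𝒜) → Bool) (f : Bits N → Bits n → Bits ℓ) →
  (∀ b → Degree< (suc d) (λ x → final 𝒜 (f x) b)) → Degree< (suc (d ℕ.+ d)) (λ x → expectation 𝒜 guess (f x))
degree-expectation {n} {ℓ} {N} {d} 𝒜 guess f amplitude = degree-sum {n = n} {ℓ} {workspace 𝒜}
  (λ x b → signed (guess b) (conj (final 𝒜 (f x) b) *ᶜ final 𝒜 (f x) b)) λ b →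
    degree-additive {h = signed (guess b)} (signed-cong (guess b)) (signed-+ (guess b)) (square b)
  where
  conj-amplitude : ∀ b → Degree< (suc d) (λ x → conj (final 𝒜 (f x) b))
  conj-amplitude b = degree-additive {h = conj} conj-cong conj-+ {λ x → final 𝒜 (f x) b} (amplitude b)
  square : ∀ b → Degree< (suc (d ℕ.+ d)) (λ x → conj (final 𝒜 (f x) b) *ᶜ final 𝒜 (f x) b)
  square b = degree-* {F = λ x → conj (final 𝒜 (f x) b)} {λ x → final 𝒜 (f x) b} (conj-amplitude b) (amplitude b)

parity-bound : (𝒜 : QueryAlgorithm n ℓ) (f : Bits N → Bits n → Bits ℓ) →
  (∀ b → Degree< (suc (queries 𝒜)) (λ x → final 𝒜 (f x) b)) →
  (P : Bits N → (Bits n → Bits n → Bool) → Set) (P? : ∀ x R → Dec (P x R))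
  (dec : (Bits n → Bits n → Bool) → Bits N) → (∀ x R → P x R → dec R ≡ x) →
  (∀ x → fromℚ (+ 2 / 3) ≤ʳ probability 𝒜 (f x) {P x} (P? x)) → N ℕ.≤ queries 𝒜 ℕ.+ queries 𝒜
-- `2T < N` is `suc (T + T) ≤ N`, which is what `altSum-degree` asks of the index `suc (T + T)`. The
-- guess is computed from the measured output and costs no query.
parity-bound {N = N} 𝒜 f degf P P? dec dec-correct 2/3≤ = ℕ.≮⇒≥ λ 2T<N →
  1/3≰ʳnull (altSum-degree (degree-expectation 𝒜 guess f degf) 2T<N)
    (altSum-lower (ℚ.nonNegative⁻¹ (+ 1 / 3)) N (λ x → expectation 𝒜 guess (f x)) λ x →
      expectation-lower 𝒜 guess (f x) (P? x) (parity x)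
        (λ b p → cong parity (dec-correct x (output 𝒜 b) p)) (2/3≤ x))
  where
  guess = parity ∘ dec ∘ output 𝒜

-- The equation f ≡ … is checked on functions; comparing the two probabilities by unfolding
-- would be infeasible.
solves-probability : {S : Signature o} {A : Algebra S (Bits n)} {𝒜 : HKPAlgorithm n} → 𝒜 SolvesHKP A →
  ∀ {X : Set} (C : Algebra S X) (label : X ↣ Bits ℓ) φ → IsHomomorphism A C φ →
  ∀ f → f ≡ (λ v → Injection.to label (φ v)) →
  ∃[ P? ] fromℚ (+ 2 / 3) ≤ʳ probability (𝒜 ℓ) f {IsKernelOf φ} P?
solves-probability solves C label φ hom f refl =
  isKernelOf? (via-injection label _≟ᵇ_) φ , solves _ C label φ hom

-- Query bound for a hidden ideal

module _ {S : Signature o} {B : Algebra S Bool} (𝓘 : IdealFamily B m) where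
  open IdealFamily 𝓘

  φ : Bits (length keys) → Bits (suc m) → Bits (suc m)
  φ x = collapse (ideal x)

  degree-φ : (𝒜 : QueryAlgorithm (suc m) (suc m)) → ∀ b → Degree< (suc (queries 𝒜)) (λ x → final 𝒜 (φ x) b)
  degree-φ = degree-final V degV answer φ φ≡
    where
    answer : Bits (suc m) → Bool → Bits (suc m)
    answer (b ∷ v) c = (if forced v ∨ c then false else b) ∷ v
    V : Bits (suc m) → Bits (length keys) → Bool
    V a x = value keys x (key (tail a))
    degV : ∀ a h → Degree< 2 (h ∘ V a)
    degV a = degree-value keys (key (tail a))
    φ≡ : ∀ x a → φ x a ≡ answer a (V a x)
    φ≡ x (_ ∷ _) = refl

  success : (𝒜 : HKPAlgorithm (suc m)) → 𝒜 SolvesHKP (B ^ᴬ suc m) → ∀ x →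
    ∃[ P? ] fromℚ (+ 2 / 3) ≤ʳ probability (𝒜 (suc m)) (φ x) {IsKernelOf (φ x)} P?
  -- The elements of the target algebra are bit vectors and serve as their own labels, so the label
  -- length is `suc m`.
  success 𝒜 solves x = solves-probability {𝒜 = 𝒜} solves (collapse-algebra (ideal x) B) (↣-id (Bits (suc m)))
    (φ x) (collapse-homomorphism (ideal x) B (compatible x)) (φ x) refl

  keys≤2queries : (𝒜 : HKPAlgorithm (suc m)) → 𝒜 SolvesHKP (B ^ᴬ suc m) →
    length keys ℕ.≤ queries (𝒜 (suc m)) ℕ.+ queries (𝒜 (suc m))
  keys≤2queries 𝒜 solves = parity-bound (𝒜 (suc m)) φ (degree-φ (𝒜 (suc m)))
    (λ x → IsKernelOf (φ x)) (λ x → proj₁ (success 𝒜 solves x))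
    (decode keys) (kernel-decode 𝓘) λ x → proj₂ (success 𝒜 solves x)

-- The exponential bound

cast : ℕ → ℚ
cast k = + k / 1

-- `_/_` reduces by a gcd and does not compute for a variable `k`; the explicit fraction exposes the
-- numerator.
cast-mkℚ : ∀ k → cast k ≡ mkℚ (+ k) 0 (coprime-sym (1-coprimeTo k))
cast-mkℚ k = ℚ.↥p/↧p≡p (mkℚ (+ k) 0 (coprime-sym (1-coprimeTo k)))

cast-+ : ∀ a b → cast (a ℕ.+ b) ≡ cast a ℚ.+ cast b
cast-+ a b = sym (trans (cong₂ ℚ._+_ (cast-mkℚ a) (cast-mkℚ b))
  (cong (_/ 1) (cong₂ ℤ._+_ (ℤ.*-identityʳ (+ a)) (ℤ.*-identityʳ (+ b)))))

cast-* : ∀ a b → cast (a ℕ.* b) ≡ cast a ℚ.* cast b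
cast-* a b = sym (trans (cong₂ ℚ._*_ (cast-mkℚ a) (cast-mkℚ b))
  (cong (_/ 1) (sym (ℤ.pos-* a b))))

cast-mono : ∀ {a b} → a ≤ b → cast a ℚ.≤ cast b
cast-mono {a} {b} a≤b = subst₂ ℚ._≤_ (sym (cast-mkℚ a)) (sym (cast-mkℚ b))
  (ℚ.*≤* (ℤ.*-monoʳ-≤-nonNeg (+ 1) (ℤ.+≤+ a≤b)))

cast-pos : ∀ k → ℚ.Positive (cast (suc k))
cast-pos k = ℚ.positive (ℚ.<-≤-trans (ℚ.positive⁻¹ 1ℚ) (cast-mono {1} {suc k} (ℕ.s≤s ℕ.z≤n)))

*-monoˡ : ∀ {p q r} → 0ℚ ℚ.≤ r → p ℚ.≤ q → r ℚ.* p ℚ.≤ r ℚ.* q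
*-monoˡ {r = r} 0≤r = ℚ.*-monoˡ-≤-nonNeg r {{ℚ.nonNegative 0≤r}}

*-nonNeg : ∀ {p q} → 0ℚ ℚ.≤ p → 0ℚ ℚ.≤ q → 0ℚ ℚ.≤ p ℚ.* q
*-nonNeg {p} {q} 0≤p 0≤q = subst (ℚ._≤ p ℚ.* q) (ℚ.*-zeroʳ p) (*-monoˡ 0≤p 0≤q)

module _ (x : ℝ) (j : ℕ) (h : ℚ) (0≤x : 0ℚ ℚ.≤ seq x j) (0≤h : 0ℚ ℚ.≤ h)
  (x[1+h]≤2 : seq x j ℚ.* (1ℚ ℚ.+ h) ℚ.≤ cast 2) where

  pow-nonNeg : ∀ n → 0ℚ ℚ.≤ seq (x ^ʳ n) j
  pow-nonNeg zero    = ℚ.nonNegative⁻¹ 1ℚ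
  pow-nonNeg (suc n) = *-nonNeg 0≤x (pow-nonNeg n)

  -- Bernoulli's inequality `1 + nh ≤ (1 + h)^n` multiplied by `x^n`, with `x(1 + h) ≤ 2`. Powers of
  -- reals are formed termwise, so everything happens at the single index `j`.
  pow-bernoulli : ∀ n → seq (x ^ʳ n) j ℚ.* (1ℚ ℚ.+ cast n ℚ.* h) ℚ.≤ cast (2 ℕ.^ n)
  pow-bernoulli zero    = ℚ.≤-reflexive (solve 1 (λ h → con 1ℚ :* (con 1ℚ :+ con 0ℚ :* h) := con 1ℚ) refl h)
    where open +-*-Solver
  pow-bernoulli (suc n) = begin
    (a ℚ.* X) ℚ.* (1ℚ ℚ.+ cast (suc n) ℚ.* h)
      ≡⟨ cong (λ k → (a ℚ.* X) ℚ.* (1ℚ ℚ.+ k ℚ.* h)) (cast-+ 1 n) ⟩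
    (a ℚ.* X) ℚ.* (1ℚ ℚ.+ (1ℚ ℚ.+ cast n) ℚ.* h)
      ≤⟨ *-monoˡ (*-nonNeg 0≤x (pow-nonNeg n)) expand ⟩
    (a ℚ.* X) ℚ.* ((1ℚ ℚ.+ cast n ℚ.* h) ℚ.* (1ℚ ℚ.+ h))
      ≡⟨ solve 4 (λ a X c d → (a :* X) :* (c :* d) :=
          (X :* c) :* (a :* d)) refl a X (1ℚ ℚ.+ cast n ℚ.* h) (1ℚ ℚ.+ h) ⟩
    (X ℚ.* (1ℚ ℚ.+ cast n ℚ.* h)) ℚ.* (a ℚ.* (1ℚ ℚ.+ h))
      ≤⟨ *-monoˡ (*-nonNeg (pow-nonNeg n) (ℚ.+-mono-≤ (ℚ.nonNegative⁻¹ 1ℚ) (*-nonNeg 0≤n 0≤h))) x[1+h]≤2 ⟩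
    (X ℚ.* (1ℚ ℚ.+ cast n ℚ.* h)) ℚ.* cast 2
      ≤⟨ ℚ.*-monoʳ-≤-nonNeg (cast 2) (pow-bernoulli n) ⟩
    cast (2 ℕ.^ n) ℚ.* cast 2
      ≡⟨ ℚ.*-comm (cast (2 ℕ.^ n)) (cast 2) ⟩
    cast 2 ℚ.* cast (2 ℕ.^ n)
      ≡⟨ cast-* 2 (2 ℕ.^ n) ⟨
    cast (2 ℕ.^ suc n) ∎
    where
    open ℚ.≤-Reasoning
    open +-*-Solver
    a = seq x j
    X = seq (x ^ʳ n) j
    0≤n : 0ℚ ℚ.≤ cast n
    0≤n = cast-mono (ℕ.z≤n {n})
    expand : 1ℚ ℚ.+ (1ℚ ℚ.+ cast n) ℚ.* h ℚ.≤ (1ℚ ℚ.+ cast n ℚ.* h) ℚ.* (1ℚ ℚ.+ h)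
    expand = begin
      1ℚ ℚ.+ (1ℚ ℚ.+ cast n) ℚ.* h
        ≡⟨ ℚ.+-identityʳ _ ⟨
      (1ℚ ℚ.+ (1ℚ ℚ.+ cast n) ℚ.* h) ℚ.+ 0ℚ
        ≤⟨ ℚ.+-monoʳ-≤ (1ℚ ℚ.+ (1ℚ ℚ.+ cast n) ℚ.* h) (*-nonNeg 0≤n (*-nonNeg 0≤h 0≤h)) ⟩
      (1ℚ ℚ.+ (1ℚ ℚ.+ cast n) ℚ.* h) ℚ.+ cast n ℚ.* (h ℚ.* h)
        ≡⟨ solve 2 (λ k h → (con 1ℚ :+ (con 1ℚ :+ k) :* h) :+ k :* (h :* h) :=
            (con 1ℚ :+ k :* h) :* (con 1ℚ :+ h)) refl (cast n) h ⟩
      (1ℚ ℚ.+ cast n ℚ.* h) ℚ.* (1ℚ ℚ.+ h) ∎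

-- One factor 2 in the 4 pays for the coordinate spent on the collapsed bit, the other for the
-- doubled degree of probabilities.
2^n≤4nT : ∀ m T N → 2 ℕ.^ m ≤ suc m ℕ.* N → N ≤ T ℕ.+ T → 2 ℕ.^ suc m ≤ (4 ℕ.* suc m) ℕ.* T
2^n≤4nT m T N 2^m≤ N≤2T = begin
  2 ℕ.* 2 ℕ.^ m                    ≤⟨ ℕ.*-monoʳ-≤ 2 2^m≤ ⟩
  2 ℕ.* (suc m ℕ.* N)              ≤⟨ ℕ.*-monoʳ-≤ 2 (ℕ.*-monoʳ-≤ (suc m) N≤2T) ⟩
  2 ℕ.* (suc m ℕ.* (T ℕ.+ T))
    ≡⟨ solve 2 (λ n T → con 2 :* (n :* (T :+ T)) := (con 4 :* n) :* T) refl (suc m) T ⟩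
  (4 ℕ.* suc m) ℕ.* T              ∎
  where
  open ℕ.≤-Reasoning
  open ℕ-Solver

-- The constant is chosen so that `4n · δ/8 = nh` for `h = δ/2`: then `(1 + ε)^n · nh` is below the
-- Bernoulli bound `2^n ≤ 4nT`, and `4n` cancels.
exponential-lower : ∀ (ε : ℝ) {γ δ} → 0ℚ ℚ.< γ → 0ℚ ℚ.< δ → ∀ m T → 2 ℕ.^ suc m ≤ (4 ℕ.* suc m) ℕ.* T →
  ∀ j → 0ℚ ℚ.+ γ ℚ.≤ seq ε j → seq ε j ℚ.+ δ ℚ.≤ 1ℚ →
  (δ ℚ.* (+ 1 / 8)) ℚ.* seq ((1ʳ +ʳ ε) ^ʳ suc m) j ℚ.≤ cast T
exponential-lower ε {γ} {δ} 0<γ 0<δ m T 2^n≤ j γ≤ε ε+δ≤1 =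
  ℚ.*-cancelˡ-≤-pos (cast (4 ℕ.* suc m)) {{cast-pos (m ℕ.+ 3 ℕ.* suc m)}} (begin
    cast (4 ℕ.* suc m) ℚ.* ((δ ℚ.* (+ 1 / 8)) ℚ.* X)
      ≡⟨ cong (ℚ._* ((δ ℚ.* (+ 1 / 8)) ℚ.* X)) (cast-* 4 (suc m)) ⟩
    (cast 4 ℚ.* cast (suc m)) ℚ.* ((δ ℚ.* (+ 1 / 8)) ℚ.* X)
      ≡⟨ solve 3 (λ k d X → (con (cast 4) :* k) :* ((d :* con (+ 1 / 8)) :* X) :=
          X :* (k :* (con ½ :* d))) refl (cast (suc m)) δ X ⟩
    X ℚ.* (cast (suc m) ℚ.* h)
      ≤⟨ *-monoˡ (pow-nonNeg (1ʳ +ʳ ε) j h 0≤x 0≤h x[1+h]≤2 (suc m)) below ⟩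
    X ℚ.* (1ℚ ℚ.+ cast (suc m) ℚ.* h)
      ≤⟨ pow-bernoulli (1ʳ +ʳ ε) j h 0≤x 0≤h x[1+h]≤2 (suc m) ⟩
    cast (2 ℕ.^ suc m)
      ≤⟨ cast-mono 2^n≤ ⟩
    cast ((4 ℕ.* suc m) ℕ.* T)
      ≡⟨ cast-* (4 ℕ.* suc m) T ⟩
    cast (4 ℕ.* suc m) ℚ.* cast T ∎)
  where
  open ℚ.≤-Reasoning
  open +-*-Solver
  X = seq ((1ʳ +ʳ ε) ^ʳ suc m) j
  ε′ = seq ε j
  h = ½ ℚ.* δ
  0≤h : 0ℚ ℚ.≤ h
  0≤h = ℚ.<⇒≤ (half-pos 0<δ)
  0≤x : 0ℚ ℚ.≤ 1ℚ ℚ.+ ε′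
  0≤x = ℚ.+-mono-≤ (ℚ.nonNegative⁻¹ 1ℚ) (ℚ.≤-trans (ℚ.≤-trans (ℚ.<⇒≤ 0<γ) (ℚ.≤-reflexive (sym (ℚ.+-identityˡ γ)))) γ≤ε)
  below : cast (suc m) ℚ.* h ℚ.≤ 1ℚ ℚ.+ cast (suc m) ℚ.* h
  below = ℚ.≤-trans (ℚ.≤-reflexive (sym (ℚ.+-identityˡ (cast (suc m) ℚ.* h))))
    (ℚ.+-monoˡ-≤ (cast (suc m) ℚ.* h) (ℚ.nonNegative⁻¹ 1ℚ))
  -- With h = δ/2 this is (2 - δ)(1 + δ/2) = 2 - δ²/2.
  x[1+h]≤2 : (1ℚ ℚ.+ ε′) ℚ.* (1ℚ ℚ.+ h) ℚ.≤ cast 2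
  x[1+h]≤2 = begin
    (1ℚ ℚ.+ ε′) ℚ.* (1ℚ ℚ.+ h)
      ≡⟨ solve 3 (λ e d h → (con 1ℚ :+ e) :* (con 1ℚ :+ h) :=
          (con 1ℚ :+ h) :* (con 1ℚ :+ (e :+ d)) :- (con 1ℚ :+ h) :* d) refl ε′ δ h ⟩
    (1ℚ ℚ.+ h) ℚ.* (1ℚ ℚ.+ (ε′ ℚ.+ δ)) ℚ.- (1ℚ ℚ.+ h) ℚ.* δ
      ≤⟨ ℚ.+-monoˡ-≤ (ℚ.- ((1ℚ ℚ.+ h) ℚ.* δ)) (*-monoˡ (ℚ.+-mono-≤ (ℚ.nonNegative⁻¹ 1ℚ) 0≤h) (ℚ.+-monoʳ-≤ 1ℚ ε+δ≤1)) ⟩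
    (1ℚ ℚ.+ h) ℚ.* (1ℚ ℚ.+ 1ℚ) ℚ.- (1ℚ ℚ.+ h) ℚ.* δ
      ≡⟨ solve 1 (λ d → (con 1ℚ :+ con ½ :* d) :* (con 1ℚ :+ con 1ℚ) :- (con 1ℚ :+ con ½ :* d) :* d :=
          con (cast 2) :- (con ½ :* d) :* d) refl δ ⟩
    cast 2 ℚ.- h ℚ.* δ
      ≤⟨ ℚ.+-monoʳ-≤ (cast 2) (ℚ.neg-antimono-≤ (*-nonNeg 0≤h (ℚ.<⇒≤ 0<δ))) ⟩
    cast 2 ℚ.+ (ℚ.- 0ℚ)
      ≡⟨⟩
    cast 2 ∎

exponential-limit : ∀ ε {γ δ} → 0ℚ ℚ.< γ → 0ℚ ℚ.< δ →
  Eventually (λ j → 0ℚ ℚ.+ γ ℚ.≤ seq ε j) → Eventually (λ j → seq ε j ℚ.+ δ ℚ.≤ 1ℚ) →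
  ∀ m T → 2 ℕ.^ suc m ≤ (4 ℕ.* suc m) ℕ.* T → fromℚ (δ ℚ.* (+ 1 / 8)) *ʳ (1ʳ +ʳ ε) ^ʳ suc m ≤ʳ fromℕ T
exponential-limit ε {γ} {δ} 0<γ 0<δ γ≤ε ε+δ≤1 m T 2^n≤ η 0<η =
  eventually-map bound (eventually-∧ γ≤ε ε+δ≤1)
  where
  open ℚ.≤-Reasoning
  X : ℕ → ℚ
  X = seq ((1ʳ +ʳ ε) ^ʳ suc m)
  bound : ∀ j → 0ℚ ℚ.+ γ ℚ.≤ seq ε j × seq ε j ℚ.+ δ ℚ.≤ 1ℚ → (δ ℚ.* (+ 1 / 8)) ℚ.* X j ℚ.≤ cast T ℚ.+ η
  bound j (γ≤ , ≤1) = begin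
    (δ ℚ.* (+ 1 / 8)) ℚ.* X j   ≤⟨ exponential-lower ε 0<γ 0<δ m T 2^n≤ j γ≤ ≤1 ⟩
    cast T                      ≡⟨ ℚ.+-identityʳ (cast T) ⟨
    cast T ℚ.+ 0ℚ               ≤⟨ ℚ.+-monoʳ-≤ (cast T) (ℚ.<⇒≤ 0<η) ⟩
    cast T ℚ.+ η                ∎

ideal-family : {S : Signature o} (B : Algebra S Bool) →
  (B ≼ ⋀) ⊎ (B ≼ ⋁) ⊎ (B ≼ 𝖴) → ∀ m → IdealFamily B m
ideal-family B (inj₁ B≼⋀)        = ⋀-family B B≼⋀
ideal-family B (inj₂ (inj₁ B≼⋁)) = ⋁-family B B≼⋁
ideal-family B (inj₂ (inj₂ B≼𝖴)) = 𝖴-family B B≼𝖴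

queries-lower : {S : Signature o} {B : Algebra S Bool} → IdealFamily B m →
  (𝒜 : HKPAlgorithm (suc m)) → 𝒜 SolvesHKP (B ^ᴬ suc m) →
  2 ℕ.^ suc m ≤ (4 ℕ.* suc m) ℕ.* queries (𝒜 (suc m))
queries-lower {m = m} 𝓘 𝒜 solves =
  2^n≤4nT m (queries (𝒜 (suc m))) (length (IdealFamily.keys 𝓘)) (IdealFamily.many 𝓘) (keys≤2queries 𝓘 𝒜 solves)

theorem5p2 : ∀ {o} {S : Signature o} (B : Algebra S Bool) →
    (B ≼ ⋀) ⊎ (B ≼ ⋁) ⊎ (B ≼ 𝖴) →
    (ε : ℝ) → 0ʳ <ʳ ε → ε <ʳ 1ʳ →
    ∃[ c ] (0ʳ <ʳ c) × (∃[ N ] ∀ (n : ℕ) → N ≤ n →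
    (𝒜 : HKPAlgorithm n) → 𝒜 SolvesHKP (B ^ᴬ n) →
    ∃[ ℓ ] (c *ʳ (1ʳ +ʳ ε) ^ʳ n ≤ʳ fromℕ (queries (𝒜 ℓ))))
theorem5p2 B cases ε (γ , 0<γ , γ≤ε) (δ , 0<δ , ε+δ≤1) =
  -- `δ` is the gap witnessing `ε <ʳ 1ʳ`, so the constant depends neither on `B` nor on `n`.
  fromℚ (δ ℚ.* (+ 1 / 8)) ,
  (δ ℚ.* (+ 1 / 8) , ℚ.*-monoˡ-<-pos (+ 1 / 8) 0<δ , 0 , λ _ _ → ℚ.≤-reflexive (ℚ.+-identityˡ (δ ℚ.* (+ 1 / 8)))) ,
  -- From `n = 1` on there is a coordinate to collapse; the other `m` coordinates carry the ideals.
  1 , λ { (suc m) _ 𝒜 solves → suc m ,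
    exponential-limit ε 0<γ 0<δ γ≤ε ε+δ≤1 m (queries (𝒜 (suc m)))
      (queries-lower (ideal-family B cases m) 𝒜 solves) }
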